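{- Let $\sigma$ be a finite relational signature and let $(\mathbf{S},\mathbf{T})$ be a PCSP template of signature $\sigma$ (so $\mathbf{S}\to\mathbf{T}$) with domains $S$ and $T$. Suppose that $(\mathbf{S},\mathbf{T})$ has sublinear width. If for all $U,V\in\mathscr{G}(\mathbf{S})$ we have $U\circ V=S^2$, then $\mathbf{T}$ is reflexive, i.e., there exists $a\in T$ such that for every $R\in\sigma$ (of arity $r$) the reflexive tuple $(a,a,\dots,a)$ belongs to $R^{\mathbf{T}}$. In particular, this conclusion holds if $(\mathbf{S},\mathbf{T})$ has bounded width.
   Context: All signatures and structures are finite. A $\sigma$-structure $\mathbf{A}$ has a domain $A$ and a relation $R^{\mathbf{A}}\subseteq A^r$ for each symbol $R\in\sigma$ of arity $r$. A homomorphism $\mathbf{A}\to\mathbf{B}$ is a map $f:A\to B$ with $f(\mathbf{a})\in R^{\mathbf{B}}$ (applied coordinatewise) for all $R\in\sigma$ and $\mathbf{a}\in R^{\mathbf{A}}$; $\mathbf{A}\to\mathbf{B}$ denotes that one exists. A PCSP template is a pair $(\mathbf{S},\mathbf{T})$ of $\sigma$-structures with $\mathbf{S}\to\mathbf{T}$. For $X\subseteq I$, $\mathbf{I}|_X$ is the induced substructure on $X$; a partial homomorphism from $\mathbf{I}$ to $\mathbf{S}$ is a map $f:X\to S$, $X\subseteq I$, that is a homomorphism from $\mathbf{I}|_X$ to $\mathbf{S}$. A $k$-strategy on $\mathbf{I}$ and $\mathbf{S}$ is a nonempty collection $\mathscr{H}$ of partial homomorphisms from $\mathbf{I}$ to $\mathbf{S}$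 that is closed under restrictions (if $h\in\mathscr{H}$ and $X\subseteq\mathrm{dom}(h)$ then $h|_X\in\mathscr{H}$) and has the extension property up to $k$ (for every $h\in\mathscr{H}$ with $|\mathrm{dom}(h)|<k$ and every $x\in I\setminus\mathrm{dom}(h)$ there is $f\in\mathscr{H}$ extending $h$ with $\mathrm{dom}(f)=\mathrm{dom}(h)\cup\{x\}$). Write $\mathbf{I}\le_k\mathbf{S}$ if a $k$-strategy on $\mathbf{I}$ and $\mathbf{S}$ exists. For an integer function $k(n)$, the template $(\mathbf{S},\mathbf{T})$ has width $k(n)$ if for every $\sigma$-structure $\mathbf{I}$ with $n$ elements, $\mathbf{I}\le_{k(n)}\mathbf{S}$ implies $\mathbf{I}\to\mathbf{T}$. It has bounded width if it has width $k(n)$ for some $k(n)=O(1)$, and sublinear width if it has width $k(n)$ for some $k(n)=o(n)$. For a relation $R\subseteq A^r$ and $i,j\in[r]$, $\mathrm{pr}_{i,j}R=\{(\mathbf{a}(i),\mathbf{a}(j))\mid \mathbf{a}\in R\}$; $\mathscr{G}(R)=\{\mathrm{pr}_{i,j}R\mid i,j\in[r],\ i\ne j\}$; and $\mathscr{G}(\mathbf{A})=\mathscr{G}(\prod_{R\in\sigma}R^{\mathbf{A}})$, where $\prod$ denotes the product (concatenation) of relations. For binary relations, $U\circ V=\{(a,b)\mid \exists c\,((a,c)\in U,\ (c,b)\in V)\}$.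
   Formalization: The formal theorem also assumes that S is nonempty and every relation of S is nonempty; without this the claim fails, e.g. for one unary symbol with S = T = ({0}, ∅), which has width 1 and an empty 𝒢(S), while T is not reflexive. -}

module Defs where

open import Data.Nat using (ℕ; zero; suc; _+_; _*_; _≤_; _<_)
open import Data.Fin using (Fin)
open import Data.Bool using (Bool; true; false; if_then_else_)
open import Data.Maybe using (Maybe; just; nothing; is-just)
open import Data.Vec using (Vec; lookup; map; replicate; allFin; sum)
open import Data.Product using (Σ; Σ-syntax; ∃; ∃-syntax; _×_; _,_; proj₁; proj₂)
open import Data.Sum using (_⊎_)
open import Relation.Binary.PropositionalEquality using (_≡_; _≢_)

record Signature : Set where
  field
    m  : ℕ
    ar : Fin m → ℕ
open Signature public

record Structure (σ : Signature) : Set where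
  field
    size : ℕ
    rel  : (R : Fin (m σ)) → Vec (Fin size) (ar σ R) → Bool
open Structure public

module _ {σ : Signature} where

  IsHom : (A B : Structure σ) → (Fin (size A) → Fin (size B)) → Set
  IsHom A B f = ∀ (R : Fin (m σ)) (t : Vec (Fin (size A)) (ar σ R)) →
    rel A R t ≡ true → rel B R (map f t) ≡ true

  _⟶_ : Structure σ → Structure σ → Set
  A ⟶ B = Σ (Fin (size A) → Fin (size B)) (IsHom A B)

  PMap : (I S : Structure σ) → Set
  PMap I S = Fin (size I) → Maybe (Fin (size S))

  IsPartialHom : (I S : Structure σ) → PMap I S → Set
  IsPartialHom I S h = ∀ (R : Fin (m σ)) (a : Vec (Fin (size I)) (ar σ R))
    (b : Vec (Fin (size S)) (ar σ R)) → rel I R a ≡ true →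
    (∀ j → h (lookup a j) ≡ just (lookup b j)) → rel S R b ≡ true

  _≼_ : {I S : Structure σ} → PMap I S → PMap I S → Set
  g ≼ h = ∀ i → g i ≡ nothing ⊎ g i ≡ h i

  domSize : {I S : Structure σ} → PMap I S → ℕ
  domSize {I} h = sum (map (λ i → if is-just (h i) then 1 else 0) (allFin (size I)))

  IsStrategy : ℕ → (I S : Structure σ) → (PMap I S → Set) → Set
  IsStrategy k I S ℋ =
      (Σ (PMap I S) ℋ)
    × (∀ h → ℋ h → IsPartialHom I S h)
    × (∀ g h → ℋ h → _≼_ {I} {S} g h → ℋ g)
    × (∀ h → ℋ h → domSize {I} {S} h < k → ∀ x → h x ≡ nothing →
         Σ (PMap I S) λ f → ℋ f × (∃ λ c → f x ≡ just c)
                          × (∀ i → i ≢ x → f i ≡ h i))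

  _≤[_]_ : Structure σ → ℕ → Structure σ → Set₁
  I ≤[ k ] S = Σ (PMap I S → Set) (IsStrategy k I S)

  HasWidth : (S T : Structure σ) → (ℕ → ℕ) → Set₁
  HasWidth S T k = ∀ (I : Structure σ) → I ≤[ k (size I) ] S → I ⟶ T

BinRel : ℕ → Set₁
BinRel s = Fin s → Fin s → Set

IsBigO1 : (ℕ → ℕ) → Set
IsBigO1 k = ∃[ C ] ∃[ N ] (∀ n → N ≤ n → k n ≤ C)

IsLittleON : (ℕ → ℕ) → Set
IsLittleON k = ∀ (c : ℕ) → ∃[ N ] (∀ n → N ≤ n → c * k n ≤ n)

module _ {σ : Signature} where

  BoundedWidth : (S T : Structure σ) → Set₁
  BoundedWidth S T = Σ (ℕ → ℕ) λ k → IsBigO1 k × HasWidth S T k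

  SublinearWidth : (S T : Structure σ) → Set₁
  SublinearWidth S T = Σ (ℕ → ℕ) λ k → IsLittleON k × HasWidth S T k

  -- Coordinates of the product relation ∏_{R∈σ} R^S (concatenation),
  -- indexed by (symbol, position within the symbol).
  Pos : Set
  Pos = Σ (Fin (m σ)) λ R → Fin (ar σ R)

  InProduct : (S : Structure σ) → ((R : Fin (m σ)) → Vec (Fin (size S)) (ar σ R)) → Set
  InProduct S t = ∀ R → rel S R (t R) ≡ true

  pr : (S : Structure σ) → Pos → Pos → BinRel (size S)
  pr S p q a b = Σ ((R : Fin (m σ)) → Vec (Fin (size S)) (ar σ R)) λ t →
    InProduct S t × lookup (t (proj₁ p)) (proj₂ p) ≡ a
                  × lookup (t (proj₁ q)) (proj₂ q) ≡ b

  𝒢Index : Set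
  𝒢Index = Σ (Pos × Pos) λ pq → proj₁ pq ≢ proj₂ pq

  𝒢 : (S : Structure σ) → 𝒢Index → BinRel (size S)
  𝒢 S ((p , q) , _) = pr S p q

  Reflexive : Structure σ → Set
  Reflexive T = Σ (Fin (size T)) λ a → ∀ R → rel T R (replicate (ar σ R) a) ≡ true

_∘ᵣ_ : {s : ℕ} → BinRel s → BinRel s → BinRel s
_∘ᵣ_ {s} U V a b = Σ (Fin s) λ c → U a c × V c b

IsFull : {s : ℕ} → BinRel s → Set
IsFull U = ∀ a b → U a b

{-# OPTIONS --safe #-}

-- If the product relation P of S has at most one coordinate, any homomorphism S ⟶ T gives the constant
-- tuple.  Otherwise let r be its arity.  A counting argument provides, for arbitrarily large n, an r-uniform
-- hypergraph with n vertices and O(n) edges in which every set of n / |T| vertices contains an edge, while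
-- any m ≤ εn edges span more than (r - 11/10) m vertices.  Read as an instance, with P imposed on every edge,
-- a homomorphism to T is a colouring by elements of T, so a monochromatic edge makes T reflexive.
--
-- It remains to see that consistency of sublinear width holds.  By discharging, every small nonempty
-- set F of edges with |F| ≥ 10 |X| has an edge meeting the rest of F and X in at most one vertex, or two
-- edges with a common private vertex that meet the rest of F and X in at most one further vertex each.  By the
-- hypothesis U ∘ V = S² such pieces can be removed and put back, so a partial map with domain X extends to a
-- solution of any small set of edges as soon as it does so for sets of size O(|X|).  The partial maps that
-- extend to solutions of all sets of at most 10 (k + 1) edges therefore form a k-strategy.
module Submission where

open import Defs
open import Data.Bool using (Bool; true; false; if_then_else_)
import Data.Bool.Properties as Bool
open import Data.Empty using (⊥; ⊥-elim)
open import Data.Fin using (Fin; zero; suc; toℕ; fromℕ<; splitAt; _↑ˡ_; _↑ʳ_)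
import Data.Fin.Properties as Fin
open import Data.Fin.Subset using (Subset; ∣_∣; inside; outside; _⊆_; _-_; _─_; _∪_; ⁅_⁆) renaming (_∈_ to _∈ₛ_; ⊥ to ∅)
open import Data.Fin.Subset.Properties
  using ( _∈?_; ∣⊥∣≡0; ∣⁅x⁆∣≡1; ∣p∣≤n; ∣p∣≤∣x∷p∣; ∣p─q∣≤∣p∣; p⊆q⇒∣p∣≤∣q∣; x∈p⇒∣p-x∣<∣p∣
        ; x∈⁅x⁆; x∈p∪q⁺; x∈p∧x≢y⇒x∈p-y; p⊆p∪q; q⊆p∪q; p─q⊆p; out⊆; s⊆s; anySubset? )
open import Data.List as List using (List; []; _∷_; _++_; length; concatMap)
open import Data.List.Membership.Propositional using (_∈_)
open import Data.List.Membership.Propositional.Properties using (∈-++⁺ˡ; ∈-++⁺ʳ; ∈-map⁺; ∈-concat⁺′; ∈-allFin)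
open import Data.List.Properties using (length-tabulate; map-tabulate)
open import Data.List.Relation.Unary.Any using (here; there)
open import Data.Maybe using (Maybe; just; nothing; is-just)
import Data.Maybe.Properties as Maybe
open import Data.Nat
  using ( ℕ; zero; suc; pred; _+_; _*_; _∸_; _^_; _!; _/_; _%_; _≤_; _<_; z≤n; s≤s; z<s; _≤?_; _<?_; >-nonZero )
open import Data.Nat.Combinatorics using () renaming (_C_ to _choose_)
import Data.Nat.Combinatorics as Comb
open import Data.Nat.DivMod using (m≡m%n+[m/n]*n; m%n<n; m/n≤m)
open import Data.Nat.Properties
open import Data.Nat.Tactic.RingSolver using (solve-∀)
open import Data.Product using (Σ; _,_; ∃; _×_; proj₁; proj₂)
open import Data.Sum using (_⊎_; inj₁; inj₂)
open import Data.Vec as Vec using (Vec; []; _∷_; lookup; tabulate; map; replicate; here; there)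
open import Data.Vec.Properties
  using ( lookup⇒[]=; []=⇒lookup; lookup-map; lookup-replicate; lookup∘tabulate; tabulate∘lookup; tabulate-cong
        ; tabulate-allFin; ≡-dec )
open import Function using (_∘_; id)
open import Relation.Nullary using (Dec; yes; no; ¬_; contradiction)
open import Relation.Nullary.Decidable using (⌊_⌋; _×-dec_; _⊎-dec_; _→-dec_; ¬?; decidable-stable; map′)
open import Relation.Unary using (Decidable)
open import Relation.Binary.PropositionalEquality
  using (_≡_; _≢_; refl; sym; trans; cong; cong₂; subst; ≢-sym; module ≡-Reasoning)

-- Numerical estimates

-- A single projection of the product relation need not be full; only the composition of two of them
-- is. An edge attached to the rest at two vertices can therefore not be put back in general, which
-- forces the search for two edges with a common private vertex.
--
-- The constant 11/10 lies between two limits. In the union bound, m edges on w vertices contribute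
-- const^m (m/n)^(rm - w - m), so the last exponent must be a positive fraction of m: the constant
-- has to exceed 1. Discharging gives 12/10 for irreducible sets, so it has to stay below that. The
-- remaining 1/10 becomes the factor 10 in front of |X|.
--
-- Extending a partial map to a further vertex costs a factor |S|: if every value were refuted by a
-- small set of edges, the union of these sets would refute the map itself. Hence sparsity is
-- required up to 10 |S| (k + 1) edges, which is still o(n).
--
-- Edges are drawn from all tuples, so that the counting sums factor; tuples with a repeated vertex
-- impose no constraint.

^-distribʳ-* : ∀ a b n → (a * b) ^ n ≡ a ^ n * b ^ n
^-distribʳ-* a b zero    = refl
^-distribʳ-* a b (suc n) rewrite ^-distribʳ-* a b n = lemma a b (a ^ n) (b ^ n)
  where
  lemma : ∀ a b x y → a * b * (x * y) ≡ a * x * (b * y)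
  lemma = solve-∀

-- The first two terms of the binomial expansion of `suc n ^ suc k`. They match the increment that
-- Pascal's rule produces in `choose-*-!`, and they give the growth used in `edge-density`.
bernoulli : ∀ n k → n ^ suc k + suc k * n ^ k ≤ suc n ^ suc k
bernoulli n zero = ≤-reflexive (lemma n)
  where
  lemma : ∀ n → n * 1 + 1 * 1 ≡ suc n * 1
  lemma = solve-∀
bernoulli n (suc k) = begin
  n * (n * x) + (2 + k) * (n * x)              ≤⟨ m≤m+n _ (suc k * x) ⟩
  n * (n * x) + (2 + k) * (n * x) + suc k * x  ≡⟨ lemma n k x ⟩
  suc n * (n * x + suc k * x)                  ≤⟨ *-monoʳ-≤ (suc n) (bernoulli n k) ⟩
  suc n * suc n ^ suc k                        ∎
  where
  open ≤-Reasoning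
  x = n ^ k
  lemma : ∀ n k x → n * (n * x) + (2 + k) * (n * x) + suc k * x ≡ suc n * (n * x + suc k * x)
  lemma = solve-∀

choose-*-! : ∀ n k → (n choose k) * k ! ≤ n ^ k
choose-*-! zero    zero    = ≤-refl
choose-*-! zero    (suc k) = z≤n
choose-*-! (suc n) zero    rewrite ^-zeroˡ 0 = ≤-refl
choose-*-! (suc n) (suc k) = begin
  (suc n choose suc k) * (suc k * k !)
    ≡⟨ cong (_* (suc k * k !)) (sym (Comb.nCk+nC[k+1]≡[n+1]C[k+1] n k)) ⟩
  (n choose k + n choose suc k) * (suc k * k !)
    ≡⟨ lemma (n choose k) (n choose suc k) k (k !) ⟩
  (n choose suc k) * (suc k * k !) + suc k * ((n choose k) * k !)
    ≤⟨ +-mono-≤ (choose-*-! n (suc k)) (*-monoʳ-≤ (suc k) (choose-*-! n k)) ⟩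
  n ^ suc k + suc k * n ^ k
    ≤⟨ bernoulli n k ⟩
  suc n ^ suc k ∎
  where
  open ≤-Reasoning
  lemma : ∀ a b k x → (a + b) * (suc k * x) ≡ b * (suc k * x) + suc k * (a * x)
  lemma = solve-∀

-- The inverse of (1 + 1/n)^m is at least 1 - m/(n + 1), by Bernoulli.
[1+n]^m≤2n^m : ∀ n m → m + m ≤ suc n → suc n ^ m ≤ 2 * n ^ m
[1+n]^m≤2n^m n m 2m≤1+n = *-cancelˡ-≤ (suc n) (begin
  suc n * suc n ^ m          ≤⟨ m≤m+n _ _ ⟩
  suc n * suc n ^ m + d * suc n ^ m ≡⟨ sym (*-distribʳ-+ (suc n ^ m) (suc n) d) ⟩
  (suc n + d) * suc n ^ m    ≡⟨ cong (_* suc n ^ m) split ⟩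
  (2 * (suc n ∸ m)) * suc n ^ m ≡⟨ *-assoc 2 (suc n ∸ m) _ ⟩
  2 * ((suc n ∸ m) * suc n ^ m) ≤⟨ *-monoʳ-≤ 2 (inverse m (≤-trans (m≤m+n m m) 2m≤1+n)) ⟩
  2 * (suc n * n ^ m)        ≡⟨ swap (suc n) (n ^ m) ⟩
  suc n * (2 * n ^ m)        ∎)
  where
  open ≤-Reasoning
  d = suc n ∸ (m + m)
  swap : ∀ a b → 2 * (a * b) ≡ a * (2 * b)
  swap = solve-∀
  m≤1+n = ≤-trans (m≤m+n m m) 2m≤1+n
  split : suc n + d ≡ 2 * (suc n ∸ m)
  split = +-cancelˡ-≡ (m + m) _ _ (≡.begin
    m + m + (suc n + d)        ≡.≡⟨ comm (m + m) (suc n) d ⟩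
    suc n + (m + m + d)        ≡.≡⟨ cong (suc n +_) (m+[n∸m]≡n 2m≤1+n) ⟩
    suc n + suc n              ≡.≡⟨ sym (cong₂ _+_ (m+[n∸m]≡n m≤1+n) (m+[n∸m]≡n m≤1+n)) ⟩
    (m + (suc n ∸ m)) + (m + (suc n ∸ m)) ≡.≡⟨ four m (suc n ∸ m) ⟩
    m + m + 2 * (suc n ∸ m)    ≡.∎)
    where
    module ≡ = ≡-Reasoning
    comm : ∀ a b c → a + (b + c) ≡ b + (a + c)
    comm = solve-∀
    four : ∀ a b → (a + b) + (a + b) ≡ a + a + 2 * b
    four = solve-∀
  inverse : ∀ k → k ≤ suc n → (suc n ∸ k) * suc n ^ k ≤ suc n * n ^ k
  inverse zero    _     = ≤-refl
  inverse (suc k) k<1+n = begin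
    x * (suc n * suc n ^ k)            ≡⟨ assoc x n (suc n ^ k) ⟩
    (x * suc n) * suc n ^ k            ≤⟨ *-monoˡ-≤ (suc n ^ k) step ⟩
    (n * suc x) * suc n ^ k            ≡⟨ *-assoc n (suc x) _ ⟩
    n * (suc x * suc n ^ k)            ≡⟨ cong (λ y → n * (y * suc n ^ k)) sx ⟩
    n * ((suc n ∸ k) * suc n ^ k)      ≤⟨ *-monoʳ-≤ n (inverse k (<⇒≤ k<1+n)) ⟩
    n * (suc n * n ^ k)                ≡⟨ assoc′ n (n ^ k) ⟩
    suc n * (n * n ^ k)                ∎
    where
    x = n ∸ k
    sx : suc x ≡ suc n ∸ k
    sx = sym (+-∸-assoc 1 (≤-pred k<1+n))
    step : x * suc n ≤ n * suc x
    step = begin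
      x * suc n  ≡⟨ *-suc x n ⟩
      x + x * n  ≤⟨ +-monoˡ-≤ (x * n) (m∸n≤m n k) ⟩
      n + x * n  ≡⟨ cong (n +_) (*-comm x n) ⟩
      n + n * x  ≡⟨ sym (*-suc n x) ⟩
      n * suc x  ∎
    assoc : ∀ x n y → x * (suc n * y) ≡ (x * suc n) * y
    assoc = solve-∀
    assoc′ : ∀ n y → n * (suc n * y) ≡ suc n * (n * y)
    assoc′ = solve-∀

halves : ∀ n → ∃ λ m → n ≤ m + m × m + m ≤ suc n
halves zero          = 0 , z≤n , z≤n
halves (suc zero)    = 1 , s≤s z≤n , ≤-refl
halves (suc (suc n)) with halves n
... | m , p , q = suc m , subst (2 + n ≤_) e (s≤s (s≤s p)) , subst (_≤ 3 + n) e (s≤s (s≤s q))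
  where
  e : suc (suc (m + m)) ≡ suc m + suc m
  e = cong suc (sym (+-suc m m))

-- The bound at half the exponent, squared: 2² = 4 serves as a crude substitute for e.
[1+n]^n≤4n^n : ∀ n → suc n ^ n ≤ 4 * n ^ n
[1+n]^n≤4n^n zero      = s≤s z≤n
[1+n]^n≤4n^n n@(suc _) with halves n
... | m , n≤2m , 2m≤1+n = *-cancelʳ-≤ _ _ (suc n ^ d) {{m^n≢0 (suc n) d}} (begin
  suc n ^ n * suc n ^ d        ≡⟨ sym (^-distribˡ-+-* (suc n) n d) ⟩
  suc n ^ (n + d)              ≡⟨ cong (suc n ^_) n+d ⟩
  suc n ^ (m + m)              ≡⟨ ^-distribˡ-+-* (suc n) m m ⟩
  suc n ^ m * suc n ^ m        ≤⟨ *-mono-≤ h h ⟩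
  (2 * n ^ m) * (2 * n ^ m)    ≡⟨ lemma (n ^ m) ⟩
  4 * (n ^ m * n ^ m)          ≡⟨ cong (4 *_) (sym (^-distribˡ-+-* n m m)) ⟩
  4 * n ^ (m + m)              ≡⟨ cong (λ x → 4 * n ^ x) (sym n+d) ⟩
  4 * n ^ (n + d)              ≡⟨ cong (4 *_) (^-distribˡ-+-* n n d) ⟩
  4 * (n ^ n * n ^ d)          ≡⟨ sym (*-assoc 4 (n ^ n) _) ⟩
  4 * n ^ n * n ^ d            ≤⟨ *-monoʳ-≤ (4 * n ^ n) (^-monoˡ-≤ d (n≤1+n n)) ⟩
  4 * n ^ n * suc n ^ d        ∎)
  where
  open ≤-Reasoning
  -- At most 1: the parity correction that makes the exponent `n + d` even.
  d = (m + m) ∸ n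
  n+d : n + d ≡ m + m
  n+d = m+[n∸m]≡n n≤2m
  h = [1+n]^m≤2n^m n m 2m≤1+n
  lemma : ∀ x → (2 * x) * (2 * x) ≡ 4 * (x * x)
  lemma = solve-∀

-- A weak Stirling bound with 4 in place of e; each induction step costs one factor (1 + 1/n)^n ≤ 4.
n^n≤4^n*n! : ∀ n → n ^ n ≤ 4 ^ n * n !
n^n≤4^n*n! zero    = ≤-refl
n^n≤4^n*n! (suc n) = begin
  suc n * suc n ^ n           ≤⟨ *-monoʳ-≤ (suc n) ([1+n]^n≤4n^n n) ⟩
  suc n * (4 * n ^ n)         ≤⟨ *-monoʳ-≤ (suc n) (*-monoʳ-≤ 4 (n^n≤4^n*n! n)) ⟩
  suc n * (4 * (4 ^ n * n !)) ≡⟨ lemma n (4 ^ n) (n !) ⟩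
  4 * 4 ^ n * (suc n * n !)   ∎
  where
  open ≤-Reasoning
  lemma : ∀ n x y → suc n * (4 * (x * y)) ≡ 4 * x * (suc n * y)
  lemma = solve-∀

-- The estimate (4n/k)^k for a binomial coefficient, multiplied out so that `k = 0` is harmless.
choose-*-^ : ∀ n k → (n choose k) * k ^ k ≤ 4 ^ k * n ^ k
choose-*-^ n k = begin
  (n choose k) * k ^ k           ≤⟨ *-monoʳ-≤ (n choose k) (n^n≤4^n*n! k) ⟩
  (n choose k) * (4 ^ k * k !)   ≡⟨ lemma (n choose k) (4 ^ k) (k !) ⟩
  4 ^ k * ((n choose k) * k !)   ≤⟨ *-monoʳ-≤ (4 ^ k) (choose-*-! n k) ⟩
  4 ^ k * n ^ k                  ∎
  where
  open ≤-Reasoning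
  lemma : ∀ a b c → a * (b * c) ≡ b * (a * c)
  lemma = solve-∀

n^n>0 : ∀ n → 0 < n ^ n
n^n>0 zero    = ≤-refl
n^n>0 (suc n) = m^n>0 (suc n) (suc n)

abstract
  -- One factor for each quantity raised to the power `m` in the union bound: 8 for summing over
  -- `m`, `4 ^ r` and 4 from the two binomial coefficients, `C` edges per vertex, and `r` from
  -- `w ≤ r * m`.
  base : ℕ → ℕ → ℕ
  base r C = 8 * 4 ^ r * 4 * C * r

  base>0 : ∀ r C → 0 < r → 0 < C → 0 < base r C
  base>0 r C r>0 C>0 = *-mono-≤ (*-mono-≤ {1} {8 * 4 ^ r * 4} (*-mono-≤ {1} {8 * 4 ^ r}
    (*-mono-≤ {1} {8} z<s (m^n>0 4 r)) (z<s {3})) C>0) r>0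

  -- Since `m ≤ 10 * j`, the factor `base ^ m` is at most `(base ^ 10) ^ j`; the last `r` comes from
  -- `(r * m) ^ j`.
  sparsity : ℕ → ℕ → ℕ
  sparsity r C = base r C ^ 10 * r

  r≤sparsity : ∀ r C → 0 < r → 0 < C → r ≤ sparsity r C
  r≤sparsity r C r>0 C>0 = m≤n*m r (base r C ^ 10) {{m^n≢0 (base r C) 10 {{>-nonZero (base>0 r C r>0 C>0)}}}}

  -- Both sides are multiplied by w^w m^m to make choose-*-^ applicable.
  sparse-estimate : ∀ r n m j w C → 0 < r → 0 < C → r * m ≡ w + (m + j) → 0 < m → m ≤ 10 * j →
    sparsity r C * m ≤ n →
    8 ^ m * ((n choose w) * ((C * n choose m) * w ^ (r * m))) ≤ n ^ (r * m)
  sparse-estimate r n m j w C r>0 C>0 rm≡ 0<m m≤10j small =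
    *-cancelʳ-≤ _ _ (w ^ w * m ^ m) {{>-nonZero (*-mono-≤ (n^n>0 w) (n^n>0 m))}} (begin
    8 ^ m * (a * (b * w ^ (r * m))) * (w ^ w * m ^ m)
      ≡⟨ l₁ (8 ^ m) a b (w ^ (r * m)) (w ^ w) (m ^ m) ⟩
    8 ^ m * ((a * w ^ w) * (b * m ^ m)) * w ^ (r * m)
      ≤⟨ *-monoˡ-≤ (w ^ (r * m)) (*-monoʳ-≤ (8 ^ m) (*-mono-≤ (choose-*-^ n w) (choose-*-^ (C * n) m))) ⟩
    8 ^ m * ((4 ^ w * n ^ w) * (4 ^ m * (C * n) ^ m)) * w ^ (r * m)
      ≡⟨ cong₂ (λ x y → 8 ^ m * ((4 ^ w * n ^ w) * (4 ^ m * x)) * y) (^-distribʳ-* C n m) ww ⟩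
    8 ^ m * ((4 ^ w * n ^ w) * (4 ^ m * (C ^ m * n ^ m))) * (w ^ w * w ^ (m + j))
      ≡⟨ l₂ (8 ^ m) (4 ^ w) (n ^ w) (4 ^ m) (C ^ m) (n ^ m) (w ^ w) (w ^ (m + j)) ⟩
    (8 ^ m * 4 ^ w * 4 ^ m * C ^ m) * w ^ (m + j) * (n ^ w * n ^ m * w ^ w)
      ≤⟨ *-monoˡ-≤ (n ^ w * n ^ m * w ^ w) main ⟩
    n ^ j * m ^ m * (n ^ w * n ^ m * w ^ w)
      ≡⟨ l₃ (n ^ j) (m ^ m) (n ^ w) (n ^ m) (w ^ w) ⟩
    n ^ w * (n ^ m * n ^ j) * (w ^ w * m ^ m)
      ≡⟨ cong (_* (w ^ w * m ^ m)) (sym nn) ⟩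
    n ^ (r * m) * (w ^ w * m ^ m) ∎)
    where
    open ≤-Reasoning
    a b B : ℕ
    a = n choose w
    b = C * n choose m
    B = base r C
    ww : w ^ (r * m) ≡ w ^ w * w ^ (m + j)
    ww = trans (cong (w ^_) rm≡) (^-distribˡ-+-* w w (m + j))
    nn : n ^ (r * m) ≡ n ^ w * (n ^ m * n ^ j)
    nn = trans (cong (n ^_) rm≡) (trans (^-distribˡ-+-* n w (m + j)) (cong (n ^ w *_) (^-distribˡ-+-* n m j)))
    l₁ : ∀ e a b x y z → e * (a * (b * x)) * (y * z) ≡ e * ((a * y) * (b * z)) * x
    l₁ = solve-∀
    l₂ : ∀ e f g h c d x y → e * ((f * g) * (h * (c * d))) * (x * y) ≡ (e * f * h * c) * y * (g * d * x)
    l₂ = solve-∀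
    l₃ : ∀ a b c d e → a * b * (c * d * e) ≡ c * (d * a) * (e * b)
    l₃ = solve-∀
    l₄ : ∀ a b c d e f g → (a * b * c * d) * (e * f * g) ≡ a * b * c * d * e * g * f
    l₄ = solve-∀
    w≤rm : w ≤ r * m
    w≤rm = ≤-trans (m≤m+n w (m + j)) (≤-reflexive (sym rm≡))
    B^m : B ^ m ≡ 8 ^ m * (4 ^ r) ^ m * 4 ^ m * C ^ m * r ^ m
    B^m = trans (^-distribʳ-* (8 * 4 ^ r * 4 * C) r m) (cong (_* r ^ m)
         (trans (^-distribʳ-* (8 * 4 ^ r * 4) C m) (cong (_* C ^ m)
         (trans (^-distribʳ-* (8 * 4 ^ r) 4 m) (cong (_* 4 ^ m) (^-distribʳ-* 8 (4 ^ r) m))))))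
    -- What is left after cancellation. The part `w ^ m` is matched by `m ^ m` up to `r ^ m`; the
    -- excess `j` has to beat all constants through `n / m`.
    main : (8 ^ m * 4 ^ w * 4 ^ m * C ^ m) * w ^ (m + j) ≤ n ^ j * m ^ m
    main = begin
      (8 ^ m * 4 ^ w * 4 ^ m * C ^ m) * w ^ (m + j)
        ≤⟨ *-mono-≤ (*-monoˡ-≤ (C ^ m) (*-monoˡ-≤ (4 ^ m) (*-monoʳ-≤ (8 ^ m) (^-monoʳ-≤ 4 w≤rm))))
                    (^-monoˡ-≤ (m + j) w≤rm) ⟩
      (8 ^ m * 4 ^ (r * m) * 4 ^ m * C ^ m) * (r * m) ^ (m + j)
        ≡⟨ cong₂ (λ x y → (8 ^ m * x * 4 ^ m * C ^ m) * y) (sym (^-*-assoc 4 r m))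
             (trans (^-distribˡ-+-* (r * m) m j) (cong (_* (r * m) ^ j) (^-distribʳ-* r m m))) ⟩
      (8 ^ m * (4 ^ r) ^ m * 4 ^ m * C ^ m) * (r ^ m * m ^ m * (r * m) ^ j)
        ≡⟨ l₄ (8 ^ m) ((4 ^ r) ^ m) (4 ^ m) (C ^ m) (r ^ m) (m ^ m) ((r * m) ^ j) ⟩
      8 ^ m * (4 ^ r) ^ m * 4 ^ m * C ^ m * r ^ m * (r * m) ^ j * m ^ m
        ≡⟨ cong (λ x → x * (r * m) ^ j * m ^ m) (sym B^m) ⟩
      B ^ m * (r * m) ^ j * m ^ m
        ≤⟨ *-monoˡ-≤ (m ^ m) (*-monoˡ-≤ ((r * m) ^ j) (^-monoʳ-≤ B {{>-nonZero (base>0 r C r>0 C>0)}} m≤10j)) ⟩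
      B ^ (10 * j) * (r * m) ^ j * m ^ m
        ≡⟨ cong (λ x → x * (r * m) ^ j * m ^ m) (sym (^-*-assoc B 10 j)) ⟩
      (B ^ 10) ^ j * (r * m) ^ j * m ^ m
        ≡⟨ cong (_* m ^ m) (sym (^-distribʳ-* (B ^ 10) (r * m) j)) ⟩
      (B ^ 10 * (r * m)) ^ j * m ^ m
        ≤⟨ *-monoˡ-≤ (m ^ m) (^-monoˡ-≤ j (≤-trans (≤-reflexive (sym (*-assoc (B ^ 10) r m))) small)) ⟩
      n ^ j * m ^ m ∎

-- A random tuple misses a given large set with probability at most D/(D+1). With `C` tuples per
-- vertex this becomes 1/8 per vertex, enough against `2 ^ n` sets; Bernoulli supplies
-- `C = 8 * D + 1`.
edge-density : ∀ D → ∃ λ C → 0 < C × 8 * D ^ C ≤ suc D ^ C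
edge-density D = suc (8 * D) , z<s , (begin
  8 * (D * D ^ k)                 ≤⟨ m≤n+m _ (D * D ^ k + D ^ k) ⟩
  D * D ^ k + D ^ k + 8 * (D * D ^ k)   ≡⟨ lemma D (D ^ k) ⟩
  D ^ suc k + suc k * D ^ k       ≤⟨ bernoulli D k ⟩
  suc D ^ suc k                   ∎)
  where
  open ≤-Reasoning
  k = 8 * D
  lemma : ∀ d x → d * x + x + 8 * (d * x) ≡ d * x + suc (8 * d) * x
  lemma = solve-∀

private variable
  A B : Set
  n k r s M : ℕ

-- Finite sums

∑ : List A → (A → ℕ) → ℕ
∑ []       f = 0
∑ (x ∷ xs) f = f x + ∑ xs f

∑-mono : ∀ (xs : List A) {f g : A → ℕ} → (∀ x → f x ≤ g x) → ∑ xs f ≤ ∑ xs g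
∑-mono []       f≤g = z≤n
∑-mono (x ∷ xs) f≤g = +-mono-≤ (f≤g x) (∑-mono xs f≤g)

∑-cong : ∀ (xs : List A) {f g : A → ℕ} → (∀ x → f x ≡ g x) → ∑ xs f ≡ ∑ xs g
∑-cong []       f≡g = refl
∑-cong (x ∷ xs) f≡g = cong₂ _+_ (f≡g x) (∑-cong xs f≡g)

∑-distrib-+ : ∀ (xs : List A) (f g : A → ℕ) → ∑ xs (λ x → f x + g x) ≡ ∑ xs f + ∑ xs g
∑-distrib-+ []       f g = refl
∑-distrib-+ (x ∷ xs) f g rewrite ∑-distrib-+ xs f g = lemma (f x) (g x) (∑ xs f) (∑ xs g)
  where
  lemma : ∀ a b c d → a + b + (c + d) ≡ a + c + (b + d)
  lemma = solve-∀

*-distribˡ-∑ : ∀ (xs : List A) c (f : A → ℕ) → ∑ xs (λ x → c * f x) ≡ c * ∑ xs f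
*-distribˡ-∑ []       c f = sym (*-zeroʳ c)
*-distribˡ-∑ (x ∷ xs) c f rewrite *-distribˡ-∑ xs c f = sym (*-distribˡ-+ c (f x) (∑ xs f))

*-distribʳ-∑ : ∀ (xs : List A) c (f : A → ℕ) → ∑ xs (λ x → f x * c) ≡ ∑ xs f * c
*-distribʳ-∑ xs c f = trans (∑-cong xs (λ x → *-comm (f x) c)) (trans (*-distribˡ-∑ xs c f) (*-comm c _))

∑-const : ∀ (xs : List A) c → ∑ xs (λ _ → c) ≡ length xs * c
∑-const []       c = refl
∑-const (x ∷ xs) c = cong (c +_) (∑-const xs c)

∑-zero : ∀ (xs : List A) → ∑ xs (λ _ → 0) ≡ 0
∑-zero xs = trans (∑-const xs 0) (*-zeroʳ (length xs))

∑-swap : ∀ (xs : List A) (ys : List B) (f : A → B → ℕ) →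
         ∑ xs (λ x → ∑ ys (f x)) ≡ ∑ ys (λ y → ∑ xs (λ x → f x y))
∑-swap []       ys f = sym (∑-zero ys)
∑-swap (x ∷ xs) ys f = trans (cong (∑ ys (f x) +_) (∑-swap xs ys f))
                             (sym (∑-distrib-+ ys (f x) (λ y → ∑ xs (λ x → f x y))))

∑-++ : ∀ (xs ys : List A) f → ∑ (xs ++ ys) f ≡ ∑ xs f + ∑ ys f
∑-++ []       ys f = refl
∑-++ (x ∷ xs) ys f = trans (cong (f x +_) (∑-++ xs ys f)) (sym (+-assoc (f x) _ _))

∑-map : ∀ (g : A → B) xs f → ∑ (List.map g xs) f ≡ ∑ xs (f ∘ g)
∑-map g []       f = refl
∑-map g (x ∷ xs) f = cong (f (g x) +_) (∑-map g xs f)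

∑-concatMap : ∀ (g : A → List B) xs f → ∑ (concatMap g xs) f ≡ ∑ xs (λ x → ∑ (g x) f)
∑-concatMap g []       f = refl
∑-concatMap g (x ∷ xs) f = trans (∑-++ (g x) (concatMap g xs) f) (cong (∑ (g x) f +_) (∑-concatMap g xs f))

∈⇒≤∑ : ∀ {xs : List A} {x} (f : A → ℕ) → x ∈ xs → f x ≤ ∑ xs f
∈⇒≤∑ f (here refl) = m≤m+n _ _
∈⇒≤∑ f (there x∈)  = ≤-trans (∈⇒≤∑ f x∈) (m≤n+m _ _)

-- The first-moment method, with totals in place of expectations: applied to a count of defects it
-- produces an object without any.
∑<length⇒∃0 : ∀ (xs : List A) f → ∑ xs f < length xs → ∃ λ x → f x ≡ 0
∑<length⇒∃0 (x ∷ xs) f lt with f x in eq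
... | zero  = x , eq
... | suc m = ∑<length⇒∃0 xs f (≤-trans (s≤s (m≤n+m (∑ xs f) m)) (≤-pred lt))

∑Fin : ∀ n → (Fin n → ℕ) → ℕ
∑Fin n = ∑ (List.allFin n)

∑Fin-suc : ∀ n f → ∑Fin (suc n) f ≡ f zero + ∑Fin n (f ∘ suc)
∑Fin-suc n f = cong (f zero +_)
  (trans (cong (λ xs → ∑ xs f) (sym (map-tabulate id suc))) (∑-map suc (List.allFin n) f))

≤∑Fin : ∀ (f : Fin n → ℕ) i → f i ≤ ∑Fin n f
≤∑Fin f i = ∈⇒≤∑ f (∈-allFin i)

𝟙 : Bool → ℕ
𝟙 b = if b then 1 else 0

𝟙≤1 : ∀ b → 𝟙 b ≤ 1
𝟙≤1 true  = ≤-refl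
𝟙≤1 false = z≤n

∑Fin-𝟙 : (p : Subset n) → ∑Fin n (𝟙 ∘ lookup p) ≡ ∣ p ∣
∑Fin-𝟙 []              = refl
∑Fin-𝟙 {suc n} (true  ∷ p) = trans (∑Fin-suc n (𝟙 ∘ lookup (true ∷ p))) (cong suc (∑Fin-𝟙 p))
∑Fin-𝟙 {suc n} (false ∷ p) = trans (∑Fin-suc n (𝟙 ∘ lookup (false ∷ p))) (∑Fin-𝟙 p)

vecs : List A → ∀ k → List (Vec A k)
vecs xs zero    = [] ∷ []
vecs xs (suc k) = concatMap (λ x → List.map (x ∷_) (vecs xs k)) xs

∑-vecs-suc : ∀ (xs : List A) k f → ∑ (vecs xs (suc k)) f ≡ ∑ xs (λ x → ∑ (vecs xs k) (λ v → f (x ∷ v)))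
∑-vecs-suc xs k f = trans (∑-concatMap _ xs f) (∑-cong xs λ x → ∑-map (x ∷_) (vecs xs k) f)

length-∑ : ∀ (xs : List A) → length xs ≡ ∑ xs (λ _ → 1)
length-∑ xs = sym (trans (∑-const xs 1) (*-identityʳ _))

∏ : Vec (A → ℕ) k → Vec A k → ℕ
∏ []       []       = 1
∏ (f ∷ fs) (x ∷ xs) = f x * ∏ fs xs

∏∑ : List A → Vec (A → ℕ) k → ℕ
∏∑ xs []       = 1
∏∑ xs (f ∷ fs) = ∑ xs f * ∏∑ xs fs

-- Distributivity in the role of independence: the coordinates of a tuple are summed separately. The
-- weights `within`, `independent` and `clustered` are products for this reason.
∑-vecs-∏ : ∀ (xs : List A) (fs : Vec (A → ℕ) k) → ∑ (vecs xs k) (∏ fs) ≡ ∏∑ xs fs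
∑-vecs-∏ xs []       = refl
∑-vecs-∏ {k = suc k} xs (f ∷ fs) = trans (∑-vecs-suc xs k _)
  (trans (∑-cong xs λ x → trans (*-distribˡ-∑ (vecs xs k) (f x) (∏ fs)) (cong (f x *_) (∑-vecs-∏ xs fs)))
         (*-distribʳ-∑ xs (∏∑ xs fs) f))

∏∑-replicate : ∀ (xs : List A) k f → ∏∑ xs (Vec.replicate k f) ≡ ∑ xs f ^ k
∏∑-replicate xs zero    f = refl
∏∑-replicate xs (suc k) f = cong (∑ xs f *_) (∏∑-replicate xs k f)

∏-positive : ∀ (fs : Vec (A → ℕ) k) v → (∀ i → 0 < lookup fs i (lookup v i)) → 0 < ∏ fs v
∏-positive []       []      pos = ≤-refl
∏-positive (f ∷ fs) (x ∷ v) pos = *-mono-≤ (pos zero) (∏-positive fs v (pos ∘ suc))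

length-vecs : ∀ (xs : List A) k → length (vecs xs k) ≡ length xs ^ k
length-vecs xs zero    = refl
length-vecs xs (suc k) = trans (length-∑ (vecs xs (suc k))) (trans (∑-vecs-suc xs k _)
  (trans (∑-cong xs λ _ → trans (sym (length-∑ (vecs xs k))) (length-vecs xs k)) (∑-const xs _)))

∈-vecs : ∀ {xs : List A} → (∀ x → x ∈ xs) → (v : Vec A k) → v ∈ vecs xs k
∈-vecs all []      = here refl
∈-vecs all (x ∷ v) = ∈-concat⁺′ (∈-map⁺ (x ∷_) (∈-vecs all v)) (∈-map⁺ _ (all x))

subsets : ∀ n → ℕ → List (Subset n)
subsets zero    zero    = [] ∷ []
subsets zero    (suc k) = []
subsets (suc n) zero    = List.map (outside ∷_) (subsets n zero)
subsets (suc n) (suc k) = List.map (inside ∷_) (subsets n k) ++ List.map (outside ∷_) (subsets n (suc k))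

∈-subsets : (p : Subset n) → p ∈ subsets n ∣ p ∣
∈-subsets []          = here refl
∈-subsets (true  ∷ p) = ∈-++⁺ˡ (∈-map⁺ (inside ∷_) (∈-subsets p))
∈-subsets (false ∷ p) with ∣ p ∣ | ∈-subsets p
... | zero  | p∈ = ∈-map⁺ (outside ∷_) p∈
... | suc k | p∈ = ∈-++⁺ʳ _ (∈-map⁺ (outside ∷_) p∈)

∑-subsets : ∀ n k (f : Subset n → ℕ) c → (∀ p → ∣ p ∣ ≡ k → f p ≤ c) → ∑ (subsets n k) f ≤ (n choose k) * c
∑-subsets zero    zero    f c h = +-monoˡ-≤ 0 (h [] refl)
∑-subsets zero    (suc k) f c h = z≤n
∑-subsets (suc n) zero    f c h = ≤-trans (≤-reflexive (∑-map (outside ∷_) (subsets n zero) f))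
  (∑-subsets n zero _ c (λ p → h (outside ∷ p)))
∑-subsets (suc n) (suc k) f c h = begin
  ∑ (List.map (inside ∷_) (subsets n k) ++ List.map (outside ∷_) (subsets n (suc k))) f
    ≡⟨ ∑-++ (List.map (inside ∷_) (subsets n k)) _ f ⟩
  ∑ (List.map (inside ∷_) (subsets n k)) f + ∑ (List.map (outside ∷_) (subsets n (suc k))) f
    ≡⟨ cong₂ _+_ (∑-map (inside ∷_) (subsets n k) f) (∑-map (outside ∷_) (subsets n (suc k)) f) ⟩
  ∑ (subsets n k) (f ∘ (inside ∷_)) + ∑ (subsets n (suc k)) (f ∘ (outside ∷_))
    ≤⟨ +-mono-≤ (∑-subsets n k _ c (λ p e → h (inside ∷ p) (cong suc e)))
                (∑-subsets n (suc k) _ c (λ p → h (outside ∷ p))) ⟩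
  (n choose k) * c + (n choose suc k) * c
    ≡⟨ sym (*-distribʳ-+ c (n choose k) (n choose suc k)) ⟩
  (n choose k + n choose suc k) * c
    ≡⟨ cong (_* c) (Comb.nCk+nC[k+1]≡[n+1]C[k+1] n k) ⟩
  (suc n choose suc k) * c ∎
  where open ≤-Reasoning

-- The sequence `2 * T (suc j)` satisfies the same hypothesis with the same `Q`, so by induction the
-- tail of the sum is at most `Q`.
∑-geometric : ∀ J (T : ℕ → ℕ) Q → (∀ (j : Fin J) → 2 ^ toℕ j * T (toℕ j) ≤ Q) → ∑Fin J (T ∘ toℕ) ≤ 2 * Q
∑-geometric zero    T Q h = z≤n
∑-geometric (suc J) T Q h = begin
  ∑Fin (suc J) (T ∘ toℕ)                    ≡⟨ ∑Fin-suc J (T ∘ toℕ) ⟩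
  T 0 + ∑Fin J (T ∘ suc ∘ toℕ)              ≤⟨ +-mono-≤ (≤-trans (≤-reflexive (sym (*-identityˡ _))) (h zero)) rest ⟩
  Q + Q                                     ≡⟨ cong (Q +_) (sym (+-identityʳ Q)) ⟩
  2 * Q                                     ∎
  where
  open ≤-Reasoning
  lemma : ∀ a b → a * (2 * b) ≡ 2 * a * b
  lemma = solve-∀
  rest : ∑Fin J (T ∘ suc ∘ toℕ) ≤ Q
  rest = *-cancelˡ-≤ 2 (begin
    2 * ∑Fin J (T ∘ suc ∘ toℕ)              ≡⟨ sym (*-distribˡ-∑ (List.allFin J) 2 (T ∘ suc ∘ toℕ)) ⟩
    ∑Fin J (λ j → 2 * T (suc (toℕ j)))      ≤⟨ ∑-geometric J (λ j → 2 * T (suc j)) Q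
      (λ j → ≤-trans (≤-reflexive (lemma (2 ^ toℕ j) (T (suc (toℕ j))))) (h (suc j))) ⟩
    2 * Q                                   ∎)

-- Counting hypergraphs

∈⇒0<𝟙 : ∀ {p : Subset n} {x} → x ∈ₛ p → 0 < 𝟙 (lookup p x)
∈⇒0<𝟙 x∈p rewrite []=⇒lookup x∈p = ≤-refl

∣p∪q∣≤∣p∣+∣q∣ : ∀ (p q : Subset n) → ∣ p ∪ q ∣ ≤ ∣ p ∣ + ∣ q ∣
∣p∪q∣≤∣p∣+∣q∣ []          []          = z≤n
∣p∪q∣≤∣p∣+∣q∣ (true  ∷ p) (t     ∷ q) =
  s≤s (≤-trans (∣p∪q∣≤∣p∣+∣q∣ p q) (+-monoʳ-≤ ∣ p ∣ (∣p∣≤∣x∷p∣ t q)))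
∣p∪q∣≤∣p∣+∣q∣ (false ∷ p) (true  ∷ q) =
  ≤-trans (s≤s (∣p∪q∣≤∣p∣+∣q∣ p q)) (≤-reflexive (sym (+-suc ∣ p ∣ ∣ q ∣)))
∣p∪q∣≤∣p∣+∣q∣ (false ∷ p) (false ∷ q) = ∣p∪q∣≤∣p∣+∣q∣ p q

x∉p─q : ∀ (p q : Subset n) {x} → x ∈ₛ q → ¬ x ∈ₛ (p ─ q)
x∉p─q (inside  ∷ p) (_ ∷ q)       here        ()
x∉p─q (outside ∷ p) (_ ∷ q)       here        ()
x∉p─q (_ ∷ p)       (outside ∷ q) (there x∈q) (there x∈) = x∉p─q p q x∈q x∈
x∉p─q (_ ∷ p)       (inside  ∷ q) (there x∈q) (there x∈) = x∉p─q p q x∈q x∈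

x∉p-x : ∀ (p : Subset n) x → ¬ x ∈ₛ (p - x)
x∉p-x p x = x∉p─q p ⁅ x ⁆ (x∈⁅x⁆ x)

∣p∣≤1+∣p-x∣ : ∀ (p : Subset n) x → ∣ p ∣ ≤ suc ∣ p - x ∣
∣p∣≤1+∣p-x∣ p x = begin
  ∣ p ∣                   ≤⟨ p⊆q⇒∣p∣≤∣q∣ cover ⟩
  ∣ ⁅ x ⁆ ∪ (p - x) ∣     ≤⟨ ∣p∪q∣≤∣p∣+∣q∣ ⁅ x ⁆ (p - x) ⟩
  ∣ ⁅ x ⁆ ∣ + ∣ p - x ∣   ≡⟨ cong (_+ ∣ p - x ∣) (∣⁅x⁆∣≡1 x) ⟩
  suc ∣ p - x ∣           ∎
  where
  open ≤-Reasoning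
  cover : p ⊆ ⁅ x ⁆ ∪ (p - x)
  cover {y} y∈p with y Fin.≟ x
  ... | yes refl = x∈p∪q⁺ (inj₁ (x∈⁅x⁆ x))
  ... | no  y≢x  = x∈p∪q⁺ (inj₂ (x∈p∧x≢y⇒x∈p-y y∈p y≢x))

superset : ∀ (p : Subset n) k → ∣ p ∣ ≤ k → k ≤ n → ∃ λ q → p ⊆ q × ∣ q ∣ ≡ k
superset []          zero    _   _   = [] , id , refl
superset (true  ∷ p) (suc k) p≤k k≤n with superset p k (≤-pred p≤k) (≤-pred k≤n)
... | q , p⊆q , e = inside ∷ q , s⊆s p⊆q , cong suc e
superset {suc n} (false ∷ p) k p≤k k≤n with k ≤? n
... | yes k≤n′ with superset p k p≤k k≤n′
...   | q , p⊆q , e = outside ∷ q , s⊆s p⊆q , e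
superset {suc n} (false ∷ p) (suc k) p≤k k≤n | no k≰n
  with superset p k (≤-trans (∣p∣≤n p) (≤-pred (≰⇒> k≰n))) (≤-pred k≤n)
... | q , p⊆q , e = inside ∷ q , out⊆ p⊆q , cong suc e
superset {suc n} (false ∷ p) zero p≤k k≤n | no k≰n = contradiction z≤n k≰n

Edge : ℕ → ℕ → Set
Edge n r = Vec (Fin n) r

edges : ∀ n r → List (Edge n r)
edges n r = vecs (List.allFin n) r

length-edges : ∀ n r → length (edges n r) ≡ n ^ r
length-edges n r = trans (length-vecs (List.allFin n) r) (cong (_^ r) (length-tabulate id))

Inj : Edge n r → Set
Inj e = ∀ p q → lookup e p ≡ lookup e q → p ≡ q

within : Subset n → Edge n r → ℕ
within W = ∏ (Vec.replicate _ (𝟙 ∘ lookup W))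

∑-within : ∀ r (W : Subset n) → ∑ (edges n r) (within W) ≡ ∣ W ∣ ^ r
∑-within {n} r W = trans (∑-vecs-∏ (List.allFin n) (Vec.replicate r (𝟙 ∘ lookup W)))
  (trans (∏∑-replicate (List.allFin n) r _) (cong (_^ r) (∑Fin-𝟙 W)))

within-positive : ∀ {W : Subset n} (e : Edge n r) → (∀ p → lookup e p ∈ₛ W) → 0 < within W e
within-positive {r = r} {W} e e⊆W = ∏-positive (Vec.replicate r (𝟙 ∘ lookup W)) e λ i →
  subst (λ f → 0 < f (lookup e i)) (sym (lookup-replicate i (𝟙 ∘ lookup W))) (∈⇒0<𝟙 (e⊆W i))

-- Each entry is removed from the set allowed to the later ones, so tuples of distinct vertices can
-- be counted coordinate by coordinate.
injective-within : Subset n → Edge n r → ℕ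
injective-within A []      = 1
injective-within A (x ∷ e) = 𝟙 (lookup A x) * injective-within (A - x) e

injective-within-≤1 : ∀ (A : Subset n) (e : Edge n r) → injective-within A e ≤ 1
injective-within-≤1 A []      = ≤-refl
injective-within-≤1 A (x ∷ e) = *-mono-≤ (𝟙≤1 (lookup A x)) (injective-within-≤1 (A - x) e)

injective-within-sound : ∀ (A : Subset n) (e : Edge n r) → 0 < injective-within A e →
                         Inj e × (∀ p → lookup e p ∈ₛ A)
injective-within-sound A []      pos = (λ ()) , (λ ())
injective-within-sound A (x ∷ e) pos with lookup A x in eq
... | true with injective-within-sound (A - x) e (subst (0 <_) (*-identityˡ _) pos)
...   | inj , e⊆ = inj′ , λ where
            zero    → x∈A
            (suc p) → p─q⊆p A ⁅ x ⁆ (e⊆ p)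
  where
  x∈A : x ∈ₛ A
  x∈A = lookup⇒[]= x A eq
  inj′ : Inj (x ∷ e)
  inj′ zero    zero    _ = refl
  inj′ zero    (suc q) h = ⊥-elim (x∉p-x A x (subst (_∈ₛ (A - x)) (sym h) (e⊆ q)))
  inj′ (suc p) zero    h = ⊥-elim (x∉p-x A x (subst (_∈ₛ (A - x)) h (e⊆ p)))
  inj′ (suc p) (suc q) h = cong suc (inj p q h)

-- The `r` spare vertices pay for the removals: every coordinate keeps at least `b` choices. A pure
-- power replaces the falling factorial, to be compared with `n ^ r`.
∑-injective-within : ∀ r b (A : Subset n) → r + b ≤ ∣ A ∣ → b ^ r ≤ ∑ (edges n r) (injective-within A)
∑-injective-within zero b A _ = ≤-refl
∑-injective-within {n} (suc r) b A r+b≤A = begin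
  b * b ^ r
    ≤⟨ *-monoˡ-≤ (b ^ r) (≤-trans (m≤n+m b (suc r)) r+b≤A) ⟩
  ∣ A ∣ * b ^ r
    ≡⟨ cong (_* b ^ r) (sym (∑Fin-𝟙 A)) ⟩
  ∑Fin n (𝟙 ∘ lookup A) * b ^ r
    ≡⟨ sym (*-distribʳ-∑ (List.allFin n) (b ^ r) (𝟙 ∘ lookup A)) ⟩
  ∑Fin n (λ x → 𝟙 (lookup A x) * b ^ r)
    ≤⟨ ∑-mono (List.allFin n) (λ x → *-monoʳ-≤ (𝟙 (lookup A x))
         (∑-injective-within r b (A - x) (≤-pred (≤-trans r+b≤A (∣p∣≤1+∣p-x∣ A x))))) ⟩
  ∑Fin n (λ x → 𝟙 (lookup A x) * ∑ (edges n r) (injective-within (A - x)))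
    ≡⟨ ∑-cong (List.allFin n) (λ x → sym (*-distribˡ-∑ (edges n r) (𝟙 (lookup A x)) _)) ⟩
  ∑Fin n (λ x → ∑ (edges n r) (λ e → injective-within A (x ∷ e)))
    ≡⟨ sym (∑-vecs-suc (List.allFin n) r (injective-within A)) ⟩
  ∑ (edges n (suc r)) (injective-within A) ∎
  where open ≤-Reasoning

-- First-moment bounds for a random hypergraph

Hypergraph : ℕ → ℕ → ℕ → Set
Hypergraph n r M = Vec (Edge n r) M

hypergraphs : ∀ n r M → List (Hypergraph n r M)
hypergraphs n r M = vecs (edges n r) M

independent : Subset n → Hypergraph n r M → ℕ
independent {M = M} A = ∏ (Vec.replicate M (λ e → 1 ∸ injective-within A e))

independent≡0 : ∀ (A : Subset n) (H : Hypergraph n r M) → independent A H ≡ 0 →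
                ∃ λ i → Inj (lookup H i) × (∀ p → lookup (lookup H i) p ∈ₛ A)
independent≡0 {M = M} A H e with Fin.any? (λ i → 0 <? injective-within A (lookup H i))
... | yes (i , pos) = i , injective-within-sound A (lookup H i) pos
... | no none = contradiction (∏-positive (Vec.replicate M _) H λ i →
        subst (λ f → 0 < f (lookup H i)) (sym (lookup-replicate {n = M} i (λ e → 1 ∸ injective-within A e)))
          (m<n⇒0<n∸m (≰⇒> (none ∘ (i ,_))))) (<⇒≱ (s≤s (≤-reflexive e)))

-- At least `b ^ r` of the `suc d * b ^ r` tuples are edges inside `A`, so each of the `M`
-- independent choices has at most `d * b ^ r` ways to avoid being one.
∑-independent : ∀ r b M d (A : Subset n) → r + b ≤ ∣ A ∣ → n ^ r ≡ suc d * b ^ r →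
                ∑ (hypergraphs n r M) (independent A) ≤ (d * b ^ r) ^ M
∑-independent {n} r b M d A r+b≤A n^r = begin
  ∑ (hypergraphs n r M) (independent A) ≡⟨ ∑-vecs-∏ (edges n r) (Vec.replicate M f) ⟩
  ∏∑ (edges n r) (Vec.replicate M f)    ≡⟨ ∏∑-replicate (edges n r) M f ⟩
  ∑ (edges n r) f ^ M                   ≤⟨ ^-monoˡ-≤ M few ⟩
  (d * b ^ r) ^ M                       ∎
  where
  open ≤-Reasoning
  g = injective-within A
  f : Edge n r → ℕ
  f e = 1 ∸ g e
  few : ∑ (edges n r) f ≤ d * b ^ r
  few = +-cancelˡ-≤ (b ^ r) _ _ (begin
    b ^ r + ∑ (edges n r) f               ≤⟨ +-monoˡ-≤ _ (∑-injective-within r b A r+b≤A) ⟩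
    ∑ (edges n r) g + ∑ (edges n r) f     ≡⟨ sym (∑-distrib-+ (edges n r) g f) ⟩
    ∑ (edges n r) (λ e → g e + f e)       ≡⟨ ∑-cong (edges n r) (λ e → m+[n∸m]≡n (injective-within-≤1 A e)) ⟩
    ∑ (edges n r) (λ _ → 1)               ≡⟨ sym (length-∑ (edges n r)) ⟩
    length (edges n r)                    ≡⟨ length-edges n r ⟩
    n ^ r                                 ≡⟨ n^r ⟩
    suc d * b ^ r                         ∎)

clustered-weights : Subset n → Subset M → Vec (Edge n r → ℕ) M
clustered-weights W = Vec.map (λ i∈F → if i∈F then within W else λ _ → 1)

clustered : Subset n → Subset M → Hypergraph n r M → ℕ
clustered W F = ∏ (clustered-weights W F)

clustered-positive : ∀ (W : Subset n) (F : Subset M) (H : Hypergraph n r M) →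
  (∀ {i} → i ∈ₛ F → ∀ p → lookup (lookup H i) p ∈ₛ W) → 0 < clustered W F H
clustered-positive {r = r} W F H F⊆W = ∏-positive (clustered-weights W F) H pos
  where
  pos : ∀ i → 0 < lookup (clustered-weights {r = r} W F) i (lookup H i)
  pos i rewrite lookup-map i (λ i∈F → if i∈F then within {r = r} W else λ _ → 1) F with lookup F i in eq
  ... | true  = within-positive (lookup H i) (F⊆W (lookup⇒[]= i F eq))
  ... | false = ≤-refl

-- Only the edges of `F` are confined to `W`; multiplying by `(n ^ r) ^ ∣ F ∣` restores their
-- missing factors and avoids the exponent `M ∸ ∣ F ∣`.
∏∑-clustered : ∀ r (W : Subset n) (F : Subset M) →
  ∏∑ (edges n r) (clustered-weights W F) * (n ^ r) ^ ∣ F ∣ ≡ (∣ W ∣ ^ r) ^ ∣ F ∣ * (n ^ r) ^ M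
∏∑-clustered r W [] = refl
∏∑-clustered {n} r W (true ∷ F) rewrite ∑-within r W =
  trans (lemma₁ w x N (N ^ ∣ F ∣)) (trans (cong (w * N *_) (∏∑-clustered r W F)) (lemma₂ w N _ _))
  where
  w = ∣ W ∣ ^ r
  N = n ^ r
  x = ∏∑ (edges n r) (clustered-weights W F)
  lemma₁ : ∀ w x n y → w * x * (n * y) ≡ w * n * (x * y)
  lemma₁ = solve-∀
  lemma₂ : ∀ w n y z → w * n * (y * z) ≡ w * y * (n * z)
  lemma₂ = solve-∀
∏∑-clustered {n} r W (false ∷ F) rewrite sym (length-∑ (edges n r)) | length-edges n r =
  trans (*-assoc N _ _) (trans (cong (N *_) (∏∑-clustered r W F)) (lemma N ((∣ W ∣ ^ r) ^ ∣ F ∣) _))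
  where
  N = n ^ r
  lemma : ∀ n y z → n * (y * z) ≡ y * (n * z)
  lemma = solve-∀

clusters : ℕ → ℕ → Hypergraph n r M → ℕ
clusters {n} {M = M} w m H = ∑ (subsets n w) λ W → ∑ (subsets M m) λ F → clustered W F H

∑-clusters : ∀ n r M w m c → 0 < n → c * ((n choose w) * ((M choose m) * w ^ (r * m))) ≤ n ^ (r * m) →
  c * ∑ (hypergraphs n r M) (clusters w m) ≤ (n ^ r) ^ M
∑-clusters n r M w m c n>0 est = *-cancelʳ-≤ _ _ N^m {{>-nonZero (n^>0 (n ^ r) (n^>0 n n>0 r) m)}} (begin
  c * ∑ (hypergraphs n r M) (clusters w m) * N^m
    ≡⟨ cong (λ x → c * x * N^m) swap ⟩
  c * ∑ (subsets n w) (λ W → ∑ (subsets M m) (X W)) * N^m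
    ≡⟨ *-assoc c _ N^m ⟩
  c * (∑ (subsets n w) (λ W → ∑ (subsets M m) (X W)) * N^m)
    ≡⟨ cong (c *_) (trans (sym (*-distribʳ-∑ (subsets n w) N^m _))
        (∑-cong (subsets n w) λ W → sym (*-distribʳ-∑ (subsets M m) N^m (X W)))) ⟩
  c * ∑ (subsets n w) (λ W → ∑ (subsets M m) (λ F → X W F * N^m))
    ≤⟨ *-monoʳ-≤ c (∑-subsets n w _ _ λ W W≡w → ∑-subsets M m _ _ λ F F≡m → ≤-reflexive (each W F W≡w F≡m)) ⟩
  c * ((n choose w) * ((M choose m) * (w ^ (r * m) * N^M)))
    ≡⟨ lemma c (n choose w) (M choose m) (w ^ (r * m)) N^M ⟩
  c * ((n choose w) * ((M choose m) * w ^ (r * m))) * N^M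
    ≤⟨ *-monoˡ-≤ N^M est ⟩
  n ^ (r * m) * N^M
    ≡⟨ trans (cong (_* N^M) (sym (^-*-assoc n r m))) (*-comm N^m N^M) ⟩
  N^M * N^m ∎)
  where
  open ≤-Reasoning
  N^m = (n ^ r) ^ m
  N^M = (n ^ r) ^ M
  n^>0 : ∀ a → 0 < a → ∀ b → 0 < a ^ b
  n^>0 a a>0 b = m^n>0 a {{>-nonZero a>0}} b
  X : Subset n → Subset M → ℕ
  X W F = ∏∑ (edges n r) (clustered-weights W F)
  swap : ∑ (hypergraphs n r M) (clusters w m) ≡ ∑ (subsets n w) (λ W → ∑ (subsets M m) (X W))
  swap = trans (∑-swap (hypergraphs n r M) (subsets n w) _) (∑-cong (subsets n w) λ W →
         trans (∑-swap (hypergraphs n r M) (subsets M m) _) (∑-cong (subsets M m) λ F →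
         ∑-vecs-∏ (edges n r) (clustered-weights W F)))
  each : ∀ W F → ∣ W ∣ ≡ w → ∣ F ∣ ≡ m → X W F * N^m ≡ w ^ (r * m) * N^M
  each W F refl refl = trans (∏∑-clustered r W F) (cong (_* N^M) (^-*-assoc w r m))
  lemma : ∀ c a b x y → c * (a * (b * (x * y))) ≡ c * (a * (b * x)) * y
  lemma = solve-∀

LargeSetsContainEdge : ℕ → Hypergraph n r M → Set
LargeSetsContainEdge {n} a H =
  ∀ (A : Subset n) → a ≤ ∣ A ∣ → ∃ λ i → Inj (lookup H i) × (∀ p → lookup (lookup H i) p ∈ₛ A)

-- Any m ≤ J edges span more than (r - 11/10) m vertices.
Sparse : ℕ → Hypergraph n r M → Set
Sparse {n} {r} {M} J H = ∀ (F : Subset M) (W : Subset n) →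
  (∀ {i} → i ∈ₛ F → ∀ p → lookup (lookup H i) p ∈ₛ W) →
  0 < ∣ F ∣ → ∣ F ∣ ≤ J → 10 * (r * ∣ F ∣) < 10 * ∣ W ∣ + 11 * ∣ F ∣

bools : List Bool
bools = true ∷ false ∷ []

∈-bools : ∀ b → b ∈ bools
∈-bools true  = here refl
∈-bools false = there (here refl)

4*2^n≤8^n : ∀ n → 0 < n → 4 * 2 ^ n ≤ 8 ^ n
4*2^n≤8^n n@(suc k) _ = begin
  4 * 2 ^ n      ≤⟨ *-monoˡ-≤ (2 ^ n) (m≤m*n 4 (4 ^ k) {{m^n≢0 4 k}}) ⟩
  4 ^ n * 2 ^ n  ≡⟨ sym (^-distribʳ-* 4 2 n) ⟩
  8 ^ n          ∎
  where open ≤-Reasoning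

independent-if-large : ℕ → Subset n → Hypergraph n r M → ℕ
independent-if-large a A H = if ⌊ a ≤? ∣ A ∣ ⌋ then independent A H else 0

#independent : ℕ → Hypergraph n r M → ℕ
#independent {n} a H = ∑ (vecs bools n) λ A → independent-if-large a A H

#independent≡0⇒large : ∀ a (H : Hypergraph n r M) → #independent a H ≡ 0 → LargeSetsContainEdge a H
#independent≡0⇒large a H none A a≤A = independent≡0 A H (n≤0⇒n≡0 (≤-trans unfold
  (≤-trans (∈⇒≤∑ (λ A → independent-if-large a A H) (∈-vecs ∈-bools A)) (≤-reflexive none))))
  where
  unfold : independent A H ≤ independent-if-large a A H
  unfold with a ≤? ∣ A ∣
  ... | yes _ = ≤-refl
  ... | no ¬p = contradiction a≤A ¬p

-- Union bound over all `2 ^ n` vertex sets. Each large one is independent with probability at most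
-- 8^(-n), which leaves at most a quarter of the hypergraphs bad.
∑-#independent : ∀ n r b d C → 0 < n → r ≤ b → n ^ r ≡ suc d * b ^ r → 8 * d ^ C ≤ suc d ^ C →
  4 * ∑ (hypergraphs n r (C * n)) (#independent (b + b)) ≤ (n ^ r) ^ (C * n)
∑-#independent n r b d C n>0 r≤b n^r dC = begin
  4 * ∑ ℋ (#independent (b + b))                  ≡⟨ cong (4 *_) (∑-swap ℋ sets _) ⟩
  4 * ∑ sets (λ A → ∑ ℋ (independent-if-large (b + b) A))
                                                  ≤⟨ *-monoʳ-≤ 4 (∑-mono sets each) ⟩
  4 * ∑ sets (λ _ → (d * b ^ r) ^ E)              ≡⟨ cong (4 *_) (∑-const sets _) ⟩
  4 * (length sets * (d * b ^ r) ^ E)             ≡⟨ cong (λ x → 4 * (x * (d * b ^ r) ^ E)) (length-vecs bools n) ⟩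
  4 * (2 ^ n * (d * b ^ r) ^ E)                   ≡⟨ sym (*-assoc 4 (2 ^ n) _) ⟩
  4 * 2 ^ n * (d * b ^ r) ^ E                     ≤⟨ *-monoˡ-≤ _ (4*2^n≤8^n n n>0) ⟩
  8 ^ n * (d * b ^ r) ^ E                         ≡⟨ cong (8 ^ n *_) (^-distribʳ-* d (b ^ r) E) ⟩
  8 ^ n * (d ^ E * (b ^ r) ^ E)                   ≡⟨ sym (*-assoc (8 ^ n) _ _) ⟩
  8 ^ n * d ^ E * (b ^ r) ^ E                     ≡⟨ cong (λ x → 8 ^ n * x * (b ^ r) ^ E) (sym (^-*-assoc d C n)) ⟩
  8 ^ n * (d ^ C) ^ n * (b ^ r) ^ E               ≡⟨ cong (_* (b ^ r) ^ E) (sym (^-distribʳ-* 8 (d ^ C) n)) ⟩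
  (8 * d ^ C) ^ n * (b ^ r) ^ E                   ≤⟨ *-monoˡ-≤ _ (^-monoˡ-≤ n dC) ⟩
  (suc d ^ C) ^ n * (b ^ r) ^ E                   ≡⟨ cong (_* (b ^ r) ^ E) (^-*-assoc (suc d) C n) ⟩
  suc d ^ E * (b ^ r) ^ E                         ≡⟨ sym (^-distribʳ-* (suc d) (b ^ r) E) ⟩
  (suc d * b ^ r) ^ E                             ≡⟨ cong (_^ E) (sym n^r) ⟩
  (n ^ r) ^ E                                     ∎
  where
  open ≤-Reasoning
  E : ℕ
  E = C * n
  ℋ = hypergraphs n r E
  sets = vecs bools n
  each : ∀ A → ∑ ℋ (independent-if-large (b + b) A) ≤ (d * b ^ r) ^ E
  each A with b + b ≤? ∣ A ∣
  -- One half of the threshold `b + b` is the room for distinct entries, as `r ≤ b`.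
  ... | yes 2b≤A = ∑-independent r b E d A (≤-trans (+-monoˡ-≤ b r≤b) 2b≤A) n^r
  ... | no  _    = ≤-trans (≤-reflexive (∑-zero ℋ)) z≤n

-- m′ = m - 1, where m is the number of edges: deficit m′ = ⌈m / 10⌉ and span r m′ = (r - 1) m - ⌈m / 10⌉.
deficit : ℕ → ℕ
deficit m′ = suc (m′ / 10)

span : ℕ → ℕ → ℕ
span r m′ = r * suc m′ ∸ (suc m′ + deficit m′)

m≤10deficit : ∀ m′ → suc m′ ≤ 10 * deficit m′
m≤10deficit m′ = begin-strict
  m′                           ≡⟨ m≡m%n+[m/n]*n m′ 10 ⟩
  m′ % 10 + m′ / 10 * 10       <⟨ +-monoˡ-< (m′ / 10 * 10) (m%n<n m′ 10) ⟩
  10 + m′ / 10 * 10            ≡⟨ *-comm (deficit m′) 10 ⟩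
  10 * deficit m′              ∎
  where open ≤-Reasoning

10deficit≤10+m′ : ∀ m′ → 10 * deficit m′ ≤ 10 + m′
10deficit≤10+m′ m′ = begin
  10 * deficit m′                     ≡⟨ *-comm 10 (deficit m′) ⟩
  10 + m′ / 10 * 10                   ≤⟨ +-monoʳ-≤ 10 (m≤n+m (m′ / 10 * 10) (m′ % 10)) ⟩
  10 + (m′ % 10 + m′ / 10 * 10)       ≡⟨ cong (10 +_) (sym (m≡m%n+[m/n]*n m′ 10)) ⟩
  10 + m′                             ∎
  where open ≤-Reasoning

-- The truncated subtraction in `span` is exact, because `deficit m′ ≤ suc m′` and `2 ≤ r`.
span+deficit : ∀ r m′ → 2 ≤ r → r * suc m′ ≡ span r m′ + (suc m′ + deficit m′)
span+deficit r m′ r≥2 = sym (m∸n+n≡m (begin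
  suc m′ + deficit m′     ≤⟨ +-monoʳ-≤ (suc m′) (s≤s (m/n≤m m′ 10)) ⟩
  suc m′ + suc m′         ≡⟨ cong (suc m′ +_) (sym (+-identityʳ (suc m′))) ⟩
  2 * suc m′              ≤⟨ *-monoˡ-≤ (suc m′) r≥2 ⟩
  r * suc m′              ∎))
  where open ≤-Reasoning

#clusters : ℕ → Hypergraph n r M → ℕ
#clusters {r = r} J H = ∑Fin J λ m′ → clusters (span r (toℕ m′)) (suc (toℕ m′)) H

-- Clusters of `suc m′` edges occur on average at most 8^(-(m′+1)) times. Eight times these counts
-- still decrease like 2^(-m′), so the total is at most 2/8 of the number of hypergraphs.
∑-#clusters : ∀ n r C J → 0 < n → 2 ≤ r → 0 < C → sparsity r C * J ≤ n →
  4 * ∑ (hypergraphs n r (C * n)) (#clusters J) ≤ (n ^ r) ^ (C * n)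
∑-#clusters n r C J n>0 r≥2 C>0 small = *-cancelˡ-≤ 2 (begin
  2 * (4 * ∑ ℋ (#clusters J))      ≡⟨ cong (λ x → 2 * (4 * x)) (∑-swap ℋ (List.allFin J) _) ⟩
  2 * (4 * ∑Fin J (T ∘ toℕ))       ≡⟨ sym (*-assoc 2 4 (∑Fin J (T ∘ toℕ))) ⟩
  8 * ∑Fin J (T ∘ toℕ)             ≡⟨ sym (*-distribˡ-∑ (List.allFin J) 8 (T ∘ toℕ)) ⟩
  ∑Fin J (λ j → 8 * T (toℕ j))     ≤⟨ ∑-geometric J (λ j → 8 * T j) Q each ⟩
  2 * Q                            ∎)
  where
  open ≤-Reasoning
  ℋ = hypergraphs n r (C * n)
  Q = (n ^ r) ^ (C * n)
  T : ℕ → ℕ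
  T m′ = ∑ ℋ (clusters (span r m′) (suc m′))
  lemma : ∀ x y → x * (8 * y) ≡ 8 * x * y
  lemma = solve-∀
  each : ∀ (j : Fin J) → 2 ^ toℕ j * (8 * T (toℕ j)) ≤ Q
  each j = begin
    2 ^ m′ * (8 * T m′)     ≡⟨ lemma (2 ^ m′) (T m′) ⟩
    8 * 2 ^ m′ * T m′       ≤⟨ *-monoˡ-≤ (T m′) (*-monoʳ-≤ 8 (^-monoˡ-≤ m′ (m≤m+n 2 6))) ⟩
    8 ^ suc m′ * T m′       ≤⟨ ∑-clusters n r (C * n) (span r m′) (suc m′) (8 ^ suc m′) n>0 estimate ⟩
    Q                       ∎
    where
    m′ = toℕ j
    estimate = sparse-estimate r n (suc m′) (deficit m′) (span r m′) C (<⇒≤ r≥2) C>0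
      (span+deficit r m′ r≥2) z<s (m≤10deficit m′)
      (≤-trans (*-monoʳ-≤ (sparsity r C) (Fin.toℕ<n j)) small)

#clusters≡0⇒sparse : ∀ J (H : Hypergraph n r M) → 2 ≤ r → r * J ≤ n → #clusters J H ≡ 0 → Sparse J H
#clusters≡0⇒sparse {n} {r} {M} J H r≥2 rJ≤n none F W F⊆W F>0 F≤J with ∣ F ∣ | ∈-subsets F
... | m@(suc m′) | F∈ with ∣ W ∣ ≤? span r m′
-- The one vertex beyond the span brings 10, which covers the rounding up in `deficit`.
...   | no W≰ = begin-strict
  10 * (r * m)                                    ≡⟨ cong (10 *_) (span+deficit r m′ r≥2) ⟩
  10 * (span r m′ + (m + deficit m′))             ≡⟨ lemma (span r m′) m (deficit m′) ⟩
  10 * span r m′ + 10 * m + 10 * deficit m′       ≤⟨ +-monoʳ-≤ (10 * span r m′ + 10 * m) (10deficit≤10+m′ m′) ⟩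
  10 * span r m′ + 10 * m + (10 + m′)             <⟨ n<1+n _ ⟩
  suc (10 * span r m′ + 10 * m + (10 + m′))       ≡⟨ lemma′ (span r m′) m′ ⟩
  10 * suc (span r m′) + 11 * m                   ≤⟨ +-monoˡ-≤ (11 * m) (*-monoʳ-≤ 10 (≰⇒> W≰)) ⟩
  10 * ∣ W ∣ + 11 * m                             ∎
  where
  open ≤-Reasoning
  lemma : ∀ s m d → 10 * (s + (m + d)) ≡ 10 * s + 10 * m + 10 * d
  lemma = solve-∀
  lemma′ : ∀ s m → suc (10 * s + 10 * suc m + (10 + m)) ≡ 10 * suc s + 11 * suc m
  lemma′ = solve-∀
-- `clusters` counts vertex sets of size exactly `span r m′`, so `W` is padded; there is room
-- because `r * J ≤ n`.
...   | yes W≤ with superset W (span r m′) W≤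
                     (≤-trans (m∸n≤m (r * m) (m + deficit m′)) (≤-trans (*-monoʳ-≤ r F≤J) rJ≤n))
...     | W′ , W⊆W′ , W′≡ = contradiction (begin-strict
  0                                                     <⟨ clustered-positive W′ F H (λ i∈F p → W⊆W′ (F⊆W i∈F p)) ⟩
  clustered W′ F H                                      ≤⟨ ∈⇒≤∑ (λ F → clustered W′ F H) F∈ ⟩
  ∑ (subsets M m) (λ F → clustered W′ F H)              ≤⟨ ∈⇒≤∑ (λ W → ∑ (subsets M m) (λ F → clustered W F H))
                                                            (subst (λ k → W′ ∈ subsets n k) W′≡ (∈-subsets W′)) ⟩
  clusters (span r m′) m H                              ≡⟨ cong (λ x → clusters (span r x) (suc x) H) (sym (Fin.toℕ-fromℕ< F≤J)) ⟩
  clusters (span r (toℕ j)) (suc (toℕ j)) H             ≤⟨ ≤∑Fin (λ m′ → clusters (span r (toℕ m′)) (suc (toℕ m′)) H) j ⟩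
  #clusters J H                                         ≡⟨ none ⟩
  0                                                     ∎) (<-irrefl refl)
  where
  open ≤-Reasoning
  j = fromℕ< F≤J

-- Each of the two kinds of defect has a total of at most a quarter of the number of hypergraphs, so
-- some hypergraph has neither.
∃-hypergraph : ∀ n r b d C J → 0 < n → 2 ≤ r → r ≤ b → 0 < C →
  n ^ r ≡ suc d * b ^ r → 8 * d ^ C ≤ suc d ^ C → sparsity r C * J ≤ n →
  Σ (Hypergraph n r (C * n)) λ H → LargeSetsContainEdge (b + b) H × Sparse J H
∃-hypergraph n r b d C J n>0 r≥2 r≤b C>0 n^r dC small = conclude (∑<length⇒∃0 ℋ (λ H → f H + g H) few-bad)
  where
  open ≤-Reasoning
  E : ℕ
  E = C * n
  ℋ = hypergraphs n r E
  f g : Hypergraph n r E → ℕ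
  f = #independent (b + b)
  g = #clusters J
  Q : ℕ
  Q = (n ^ r) ^ E
  Q>0 : 0 < Q
  Q>0 = m^n>0 (n ^ r) {{m^n≢0 n r {{>-nonZero n>0}}}} E
  lemma : ∀ q → q + q + (q + q) ≡ 4 * q
  lemma = solve-∀
  few-bad : ∑ ℋ (λ H → f H + g H) < length ℋ
  few-bad = *-cancelˡ-< 4 _ _ (begin-strict
    4 * ∑ ℋ (λ H → f H + g H)         ≡⟨ cong (4 *_) (∑-distrib-+ ℋ f g) ⟩
    4 * (∑ ℋ f + ∑ ℋ g)               ≡⟨ *-distribˡ-+ 4 (∑ ℋ f) (∑ ℋ g) ⟩
    4 * ∑ ℋ f + 4 * ∑ ℋ g             ≤⟨ +-mono-≤ (∑-#independent n r b d C n>0 r≤b n^r dC)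
                                                  (∑-#clusters n r C J n>0 r≥2 C>0 small) ⟩
    Q + Q                             <⟨ m<m+n (Q + Q) (+-mono-≤ Q>0 z≤n) ⟩
    Q + Q + (Q + Q)                   ≡⟨ lemma Q ⟩
    4 * Q                             ≡⟨ cong (4 *_) (sym (trans (length-vecs (edges n r) E) (cong (_^ E) (length-edges n r)))) ⟩
    4 * length ℋ                      ∎)
  conclude : (∃ λ H → f H + g H ≡ 0) → Σ (Hypergraph n r (C * n)) λ H → LargeSetsContainEdge (b + b) H × Sparse J H
  conclude (H , none) = H
    , #independent≡0⇒large (b + b) H (m+n≡0⇒m≡0 (f H) none)
    , #clusters≡0⇒sparse J H r≥2 (≤-trans (*-monoˡ-≤ J (r≤sparsity r C (<⇒≤ r≥2) C>0)) small)
        (m+n≡0⇒n≡0 (f H) none)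

-- Reducible sets of edges

𝟙-yes : ∀ {A : Set} (d : Dec A) → A → 𝟙 ⌊ d ⌋ ≡ 1
𝟙-yes (yes _) a = refl
𝟙-yes (no ¬a) a = contradiction a ¬a

𝟙-no : ∀ {A : Set} (d : Dec A) → ¬ A → 𝟙 ⌊ d ⌋ ≡ 0
𝟙-no (yes a) ¬a = contradiction a ¬a
𝟙-no (no _)  ¬a = refl

𝟙>0 : ∀ {A : Set} (d : Dec A) → 0 < 𝟙 ⌊ d ⌋ → A
𝟙>0 (yes a) _ = a

0<m*n⇒0<m : ∀ m {n} → 0 < m * n → 0 < m
0<m*n⇒0<m (suc m) _ = z<s

0<m*n⇒0<n : ∀ m {n} → 0 < m * n → 0 < n
0<m*n⇒0<n m {zero}  h rewrite *-zeroʳ m = h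
0<m*n⇒0<n m {suc n} h = z<s

∑Fin-const : ∀ n c → ∑Fin n (λ _ → c) ≡ n * c
∑Fin-const n c = trans (∑-const (List.allFin n) c) (cong (_* c) (length-tabulate {n = n} id))

without : Fin n → (Fin n → ℕ) → Fin n → ℕ
without i f j = if ⌊ j Fin.≟ i ⌋ then 0 else f j

without-≢ : ∀ (f : Fin n → ℕ) {i j} → j ≢ i → without i f j ≡ f j
without-≢ f {i} {j} j≢i with j Fin.≟ i
... | yes j≡i = contradiction j≡i j≢i
... | no  _   = refl

∑Fin-without : ∀ (f : Fin n → ℕ) i → ∑Fin n f ≡ f i + ∑Fin n (without i f)
∑Fin-without {suc n} f zero = trans (∑Fin-suc n f) (cong (f zero +_) (sym (∑Fin-suc n (without zero f))))
∑Fin-without {suc n} f (suc i) = trans (∑Fin-suc n f) (trans (cong (f zero +_) (∑Fin-without (f ∘ suc) i))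
  (trans (lemma (f zero) (f (suc i)) (∑Fin n (without i (f ∘ suc)))) (cong (f (suc i) +_)
    (sym (trans (∑Fin-suc n (without (suc i) f)) (cong (f zero +_) (∑-cong (List.allFin n) shift)))))))
  where
  lemma : ∀ a b c → a + (b + c) ≡ b + (a + c)
  lemma = solve-∀
  shift : ∀ j → without (suc i) f (suc j) ≡ without i (f ∘ suc) j
  shift j with j Fin.≟ i
  ... | yes _ = refl
  ... | no  _ = refl

∑Fin-≥₂ : ∀ (f : Fin n → ℕ) {i j} → j ≢ i → f i + f j ≤ ∑Fin n f
∑Fin-≥₂ {n} f {i} {j} j≢i = begin
  f i + f j                    ≡⟨ cong (f i +_) (sym (without-≢ f j≢i)) ⟩
  f i + without i f j          ≤⟨ +-monoʳ-≤ (f i) (≤∑Fin (without i f) j) ⟩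
  f i + ∑Fin n (without i f)   ≡⟨ sym (∑Fin-without f i) ⟩
  ∑Fin n f                     ∎
  where open ≤-Reasoning

∑Fin-≥₃ : ∀ (f : Fin n → ℕ) {i j k} → j ≢ i → k ≢ i → k ≢ j → f i + (f j + f k) ≤ ∑Fin n f
∑Fin-≥₃ {n} f {i} {j} {k} j≢i k≢i k≢j = begin
  f i + (f j + f k)                        ≡⟨ cong₂ (λ x y → f i + (x + y)) (sym (without-≢ f j≢i)) (sym (without-≢ f k≢i)) ⟩
  f i + (without i f j + without i f k)    ≤⟨ +-monoʳ-≤ (f i) (∑Fin-≥₂ (without i f) k≢j) ⟩
  f i + ∑Fin n (without i f)               ≡⟨ sym (∑Fin-without f i) ⟩
  ∑Fin n f                                 ∎
  where open ≤-Reasoning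

∑Fin-≤1 : ∀ n (f : Fin n → ℕ) → (∀ i → f i ≤ 1) → (∀ i j → 0 < f i → 0 < f j → i ≡ j) → ∑Fin n f ≤ 1
∑Fin-≤1 n f f≤1 unique with Fin.any? (λ i → 0 <? f i)
... | no none = ≤-trans (≤-reflexive (trans (∑-cong (List.allFin n) λ i → n≤0⇒n≡0 (≤-pred (≰⇒> (none ∘ (i ,_)))))
                  (∑-zero (List.allFin n)))) z≤n
... | yes (i , fi>0) = ≤-trans (≤-reflexive (trans (∑Fin-without f i) (trans (cong (f i +_)
                  (trans (∑-cong (List.allFin n) others) (∑-zero (List.allFin n)))) (+-identityʳ (f i))))) (f≤1 i)
  where
  others : ∀ j → without i f j ≡ 0
  others j with j Fin.≟ i
  ... | yes _   = refl
  ... | no  j≢i = n≤0⇒n≡0 (≤-pred (≰⇒> λ fj>0 → j≢i (unique j i fj>0 fi>0)))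

∑Fin-δ : ∀ (g : Fin n → ℕ) u → ∑Fin n (λ v → 𝟙 ⌊ u Fin.≟ v ⌋ * g v) ≡ g u
∑Fin-δ {n} g u = trans (∑Fin-without f u) (trans (cong₂ _+_ at-u
  (trans (∑-cong (List.allFin n) others) (∑-zero (List.allFin n)))) (+-identityʳ (g u)))
  where
  f : Fin n → ℕ
  f v = 𝟙 ⌊ u Fin.≟ v ⌋ * g v
  at-u : f u ≡ g u
  at-u = trans (cong (_* g u) (𝟙-yes (u Fin.≟ u) refl)) (*-identityˡ (g u))
  others : ∀ v → without u f v ≡ 0
  others v with v Fin.≟ u
  ... | yes _   = refl
  ... | no  v≢u = cong (_* g v) (𝟙-no (u Fin.≟ v) (≢-sym v≢u))

count : {P : Fin n → Set} → Decidable P → ℕ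
count {n} P? = ∑Fin n λ i → 𝟙 ⌊ P? i ⌋

count≤1 : ∀ {P : Fin n → Set} (P? : Decidable P) → 0 < n → count P? ≤ 1 → ∃ λ p → ∀ q → q ≢ p → ¬ P q
count≤1 P? (s≤s _) few with Fin.any? P?
-- With no such element an arbitrary one is exempted.
... | no none = zero , λ q _ Pq → none (q , Pq)
... | yes (p , Pp) = p , λ q q≢p Pq → contradiction
  (subst (_≤ 1) (cong₂ _+_ (𝟙-yes (P? p) Pp) (𝟙-yes (P? q) Pq)) (≤-trans (∑Fin-≥₂ (λ i → 𝟙 ⌊ P? i ⌋) q≢p) few))
  λ { (s≤s ()) }

another : 2 ≤ n → (p : Fin n) → ∃ λ q → q ≢ p
another (s≤s (s≤s _)) zero    = suc zero , λ ()
another (s≤s (s≤s _)) (suc _) = zero , λ ()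

count≤2 : ∀ {P : Fin n → Set} (P? : Decidable P) → 2 ≤ n → count P? ≤ 2 → ∀ p → P p →
          ∃ λ p′ → p′ ≢ p × (∀ q → q ≢ p → q ≢ p′ → ¬ P q)
count≤2 P? n≥2 few p Pp with Fin.any? (λ q → ¬? (q Fin.≟ p) ×-dec P? q)
... | yes (p′ , p′≢p , Pp′) = p′ , p′≢p , λ q q≢p q≢p′ Pq → contradiction
  (subst (_≤ 2) (cong₂ _+_ (𝟙-yes (P? p) Pp) (cong₂ _+_ (𝟙-yes (P? p′) Pp′) (𝟙-yes (P? q) Pq)))
    (≤-trans (∑Fin-≥₃ (λ i → 𝟙 ⌊ P? i ⌋) p′≢p q≢p q≢p′) few))
  λ { (s≤s (s≤s ())) }
... | no none = let p′ , p′≢p = another n≥2 p in p′ , p′≢p , λ q q≢p _ Pq → none (q , q≢p , Pq)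

-- The critical case is degree 2 outside `X`, where the right side is 20: two light incidences would
-- need 4·2 + 2·2 + 10 = 22, one needs exactly 20. This is the case that excluding a `LightPath`
-- controls.
vertex-payment : ∀ d ℓ x (covered : Dec (1 ≤ d)) (shared : Dec (2 ≤ d + 𝟙 x)) → ℓ ≤ d → (d + 𝟙 x ≤ 2 → ℓ ≤ 1) →
  𝟙 ⌊ shared ⌋ * (4 * d + 2 * ℓ) + 10 * 𝟙 ⌊ covered ⌋ ≤ 10 * (d + 𝟙 x)
vertex-payment d ℓ x (yes d≥1) (no _) _ _ = *-monoʳ-≤ 10 (≤-trans d≥1 (m≤m+n d (𝟙 x)))
vertex-payment d ℓ x (no _)    (no _) _ _ = z≤n
vertex-payment d ℓ x covered (yes shared) ℓ≤d ℓ≤1 =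
  ≤-trans (+-mono-≤ (≤-reflexive (*-identityˡ (4 * d + 2 * ℓ))) (*-monoʳ-≤ 10 (𝟙≤1 ⌊ covered ⌋))) (pay d x shared ℓ≤d ℓ≤1)
  where
  open ≤-Reasoning
  lemma₁ : ∀ d → 4 * d + 2 * d + 10 + 4 * d ≡ 10 * (d + 1)
  lemma₁ = solve-∀
  lemma₂ : ∀ k → 4 * (3 + k) + 2 * (3 + k) + 10 + (2 + 4 * k) ≡ 10 * (3 + k + 0)
  lemma₂ = solve-∀
  pay : ∀ d x → 2 ≤ d + 𝟙 x → ℓ ≤ d → (d + 𝟙 x ≤ 2 → ℓ ≤ 1) → 4 * d + 2 * ℓ + 10 ≤ 10 * (d + 𝟙 x)
  pay d true _ ℓ≤d _ = begin
    4 * d + 2 * ℓ + 10            ≤⟨ +-monoˡ-≤ 10 (+-monoʳ-≤ (4 * d) (*-monoʳ-≤ 2 ℓ≤d)) ⟩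
    4 * d + 2 * d + 10            ≤⟨ m≤m+n _ (4 * d) ⟩
    4 * d + 2 * d + 10 + 4 * d    ≡⟨ lemma₁ d ⟩
    10 * (d + 1)                  ∎
  pay (suc zero) false (s≤s ()) _ _
  pay (suc (suc zero)) false _ _ ℓ≤1 = +-monoˡ-≤ 10 (+-monoʳ-≤ 8 (*-monoʳ-≤ 2 (ℓ≤1 ≤-refl)))
  pay (suc (suc (suc k))) false _ ℓ≤d _ = begin
    4 * (3 + k) + 2 * ℓ + 10                      ≤⟨ +-monoˡ-≤ 10 (+-monoʳ-≤ (4 * (3 + k)) (*-monoʳ-≤ 2 ℓ≤d)) ⟩
    4 * (3 + k) + 2 * (3 + k) + 10                ≤⟨ m≤m+n _ (2 + 4 * k) ⟩
    4 * (3 + k) + 2 * (3 + k) + 10 + (2 + 4 * k)  ≡⟨ lemma₂ k ⟩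
    10 * (3 + k + 0)                              ∎

Inj? : (e : Edge n r) → Dec (Inj e)
Inj? e = Fin.all? λ p → Fin.all? λ q → (lookup e p Fin.≟ lookup e q) →-dec (p Fin.≟ q)

-- Discharging on a set of edges

module _ {n r M : ℕ} (H : Hypergraph n r M) (X : Subset n) (F : Subset M) where

  private
    at : Fin M → Fin r → Fin n
    at i p = lookup (lookup H i) p

  Only₁ : Fin M → Fin n → Set
  Only₁ i v = ¬ v ∈ₛ X × (∀ k p → k ∈ₛ F → k ≢ i → at k p ≢ v)

  Only₂ : Fin M → Fin M → Fin n → Set
  Only₂ i j v = ¬ v ∈ₛ X × (∀ k p → k ∈ₛ F → k ≢ i → k ≢ j → at k p ≢ v)

  -- In `leaf`, `p` is the only position that may touch the rest. In `path`, `p` and `q` mark the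
  -- common vertex while `p′` and `q′` are the possible attachments, which may coincide as vertices.
  data Reducible : Set where
    degenerate : ∀ i → i ∈ₛ F → ¬ Inj (lookup H i) → Reducible
    leaf : ∀ i p → i ∈ₛ F → Inj (lookup H i) → (∀ q → q ≢ p → Only₁ i (at i q)) → Reducible
    path : ∀ i j p p′ q q′ → i ∈ₛ F → j ∈ₛ F → i ≢ j → Inj (lookup H i) → Inj (lookup H j) →
           p′ ≢ p → q′ ≢ q → at i p ≡ at j q → Only₂ i j (at i p) →
           (∀ x → x ≢ p → x ≢ p′ → Only₁ i (at i x)) →
           (∀ x → x ≢ q → x ≢ q′ → Only₁ j (at j x)) → Reducible

  -- Counted with multiplicity, so that the degrees sum to `r * ∣ F ∣` even when tuples repeat
  -- vertices.
  incidence : Fin n → Fin M → ℕ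
  incidence v i = ∑Fin r λ p → 𝟙 ⌊ at i p Fin.≟ v ⌋

  𝟙F : Fin M → ℕ
  𝟙F i = 𝟙 (lookup F i)

  degree : Fin n → ℕ
  degree v = ∑Fin M λ i → 𝟙F i * incidence v i

  load : Fin n → ℕ
  load v = degree v + 𝟙 (lookup X v)

  shared? : ∀ v → Dec (2 ≤ load v)
  shared? v = 2 ≤? load v

  #shared : Fin M → ℕ
  #shared i = count (λ p → shared? (at i p))

  light? : ∀ i → Dec (#shared i ≤ 2)
  light? i = #shared i ≤? 2

  -- An incidence at a shared vertex is charged 6 if its edge is light and 4 otherwise; each edge then
  -- receives at least 12, while a vertex v pays at most 10 (load v - 1).
  charge : Fin M → ℕ
  charge i = 4 + 2 * 𝟙 ⌊ light? i ⌋

  incident : ∀ {i} p {v} → at i p ≡ v → 1 ≤ incidence v i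
  incident {i} p {v} e = subst (_≤ incidence v i) (𝟙-yes (at i p Fin.≟ v) e) (≤∑Fin (λ p → 𝟙 ⌊ at i p Fin.≟ v ⌋) p)

  incident⁻¹ : ∀ {i v} → 0 < incidence v i → ∃ λ p → at i p ≡ v
  incident⁻¹ {i} {v} pos with Fin.any? (λ p → at i p Fin.≟ v)
  ... | yes found = found
  ... | no  none  = contradiction (subst (0 <_) (trans (∑-cong (List.allFin r) λ p → 𝟙-no (at i p Fin.≟ v) (none ∘ (p ,_)))
                      (∑-zero (List.allFin r))) pos) λ ()

  𝟙F-∈ : ∀ {i} → i ∈ₛ F → 𝟙F i ≡ 1
  𝟙F-∈ i∈F rewrite []=⇒lookup i∈F = refl

  𝟙F>0 : ∀ {i} → 0 < 𝟙F i → i ∈ₛ F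
  𝟙F>0 {i} pos with lookup F i in eq
  ... | true = lookup⇒[]= i F eq

  F-incident : ∀ {i} p {v} → i ∈ₛ F → at i p ≡ v → 1 ≤ 𝟙F i * incidence v i
  F-incident {i} p {v} i∈F e rewrite 𝟙F-∈ i∈F = subst (1 ≤_) (sym (*-identityˡ _)) (incident p e)

  𝟙X-∈ : ∀ {v} → v ∈ₛ X → 1 ≤ 𝟙 (lookup X v)
  𝟙X-∈ v∈X rewrite []=⇒lookup v∈X = ≤-refl

  degree≥₁ : ∀ {i} p {v} → i ∈ₛ F → at i p ≡ v → 1 ≤ degree v
  degree≥₁ {i} p {v} i∈F e = ≤-trans (F-incident p i∈F e) (≤∑Fin (λ i → 𝟙F i * incidence v i) i)

  degree≥₂ : ∀ {i j} p q {v} → j ≢ i → i ∈ₛ F → j ∈ₛ F → at i p ≡ v → at j q ≡ v → 2 ≤ degree v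
  degree≥₂ p q {v} j≢i i∈F j∈F e e′ = ≤-trans (+-mono-≤ (F-incident p i∈F e) (F-incident q j∈F e′))
    (∑Fin-≥₂ (λ i → 𝟙F i * incidence v i) j≢i)

  degree≥₃ : ∀ {i j k} p q x {v} → j ≢ i → k ≢ i → k ≢ j → i ∈ₛ F → j ∈ₛ F → k ∈ₛ F →
             at i p ≡ v → at j q ≡ v → at k x ≡ v → 3 ≤ degree v
  degree≥₃ p q x {v} j≢i k≢i k≢j i∈F j∈F k∈F e e′ e″ =
    ≤-trans (+-mono-≤ (F-incident p i∈F e) (+-mono-≤ (F-incident q j∈F e′) (F-incident x k∈F e″)))
      (∑Fin-≥₃ (λ i → 𝟙F i * incidence v i) j≢i k≢i k≢j)

  unshared⇒only₁ : ∀ {i} p → i ∈ₛ F → ¬ 2 ≤ load (at i p) → Only₁ i (at i p)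
  unshared⇒only₁ {i} p i∈F ¬sh =
    (λ v∈X → ¬sh (+-mono-≤ (degree≥₁ p i∈F refl) (𝟙X-∈ v∈X))) ,
    (λ k q k∈F k≢i e → ¬sh (≤-trans (degree≥₂ p q k≢i i∈F k∈F refl e) (m≤m+n _ _)))

  load≤2⇒only₂ : ∀ {i j} p q → j ≢ i → i ∈ₛ F → j ∈ₛ F → at i p ≡ at j q → load (at i p) ≤ 2 → Only₂ i j (at i p)
  load≤2⇒only₂ {i} {j} p q j≢i i∈F j∈F e small =
    (λ v∈X → <⇒≱ (+-mono-≤ (degree≥₂ p q j≢i i∈F j∈F refl (sym e)) (𝟙X-∈ v∈X)) small) ,
    (λ k x k∈F k≢i k≢j e′ → <⇒≱ (≤-trans (degree≥₃ p q x j≢i k≢i k≢j i∈F j∈F k∈F refl (sym e) e′) (m≤m+n _ _)) small)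

  LightPath : Fin M → Fin M → Fin r → Fin r → Set
  LightPath i j p q = i ∈ₛ F × j ∈ₛ F × j ≢ i × #shared i ≤ 2 × #shared j ≤ 2 × at i p ≡ at j q × load (at i p) ≤ 2

  lightPath? : ∀ i j p q → Dec (LightPath i j p q)
  lightPath? i j p q = (i ∈? F) ×-dec (j ∈? F) ×-dec ¬? (j Fin.≟ i) ×-dec light? i ×-dec light? j
    ×-dec (at i p Fin.≟ at j q) ×-dec (load (at i p) ≤? 2)

  -- The common vertex uses up one of the at most two shared positions of a light edge, so each edge
  -- has at most one further attachment.
  lightPath⇒reducible : 2 ≤ r → (∀ i → i ∈ₛ F → Inj (lookup H i)) → ∀ {i j p q} → LightPath i j p q → Reducible
  lightPath⇒reducible r≥2 inj {i} {j} {p} {q} (i∈F , j∈F , j≢i , li , lj , e , small)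
    with count≤2 (λ x → shared? (at i x)) r≥2 li p sh
       | count≤2 (λ x → shared? (at j x)) r≥2 lj q (subst (λ v → 2 ≤ load v) e sh)
    where
    sh : 2 ≤ load (at i p)
    sh = ≤-trans (degree≥₂ p q j≢i i∈F j∈F refl (sym e)) (m≤m+n _ _)
  ... | p′ , p′≢p , rest | q′ , q′≢q , rest′ =
    path i j p p′ q q′ i∈F j∈F (≢-sym j≢i) (inj i i∈F) (inj j j∈F) p′≢p q′≢q e
      (load≤2⇒only₂ p q j≢i i∈F j∈F e small)
      (λ x x≢p x≢p′ → unshared⇒only₁ x i∈F (rest x x≢p x≢p′))
      (λ x x≢q x≢q′ → unshared⇒only₁ x j∈F (rest′ x x≢q x≢q′))

  covered : Subset n
  covered = tabulate λ v → ⌊ 1 ≤? degree v ⌋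

  covered-⊇ : ∀ {i} → i ∈ₛ F → ∀ p → at i p ∈ₛ covered
  covered-⊇ {i} i∈F p = lookup⇒[]= (at i p) covered (trans (lookup∘tabulate _ (at i p)) yes-true)
    where
    yes-true : ⌊ 1 ≤? degree (at i p) ⌋ ≡ true
    yes-true with 1 ≤? degree (at i p)
    ... | yes _ = refl
    ... | no ¬d = contradiction (degree≥₁ p i∈F refl) ¬d

  ∑-degree : ∑Fin n degree ≡ r * ∣ F ∣
  ∑-degree = trans (∑-swap (List.allFin n) (List.allFin M) (λ v i → 𝟙F i * incidence v i))
    (trans (∑-cong (List.allFin M) λ i → trans (*-distribˡ-∑ (List.allFin n) (𝟙F i) (λ v → incidence v i))
      (trans (cong (𝟙F i *_) (∑-incidence i)) (*-comm (𝟙F i) r)))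
    (trans (*-distribˡ-∑ (List.allFin M) r 𝟙F) (cong (r *_) (∑Fin-𝟙 F))))
    where
    ∑-incidence : ∀ i → ∑Fin n (λ v → incidence v i) ≡ r
    ∑-incidence i = trans (∑-swap (List.allFin n) (List.allFin r) _)
      (trans (∑-cong (List.allFin r) λ p → trans (∑-cong (List.allFin n) λ v → sym (*-identityʳ _)) (∑Fin-δ (λ _ → 1) (at i p)))
      (trans (∑Fin-const r 1) (*-identityʳ r)))

  module _ (inj : ∀ i → i ∈ₛ F → Inj (lookup H i))
           (no-leaf : ∀ i → i ∈ₛ F → 2 ≤ #shared i)
           (no-path : ∀ i j p q → ¬ LightPath i j p q) where

    private
      sh : Fin n → ℕ
      sh v = 𝟙 ⌊ shared? v ⌋

      vertex-charge : Fin n → ℕ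
      vertex-charge v = ∑Fin M λ i → 𝟙F i * incidence v i * charge i

      light-incidences : Fin n → ℕ
      light-incidences v = ∑Fin M λ i → 𝟙F i * incidence v i * 𝟙 ⌊ light? i ⌋

    -- A light edge has at least 2 shared positions worth 6, any other edge at least 3 worth 4; both
    -- products are 12.
    edge-charge : ∀ i → 12 * 𝟙F i ≤ 𝟙F i * (#shared i * charge i)
    edge-charge i with lookup F i in eq
    ... | false = z≤n
    ... | true with light? i
    ...   | yes _ = subst (12 ≤_) (sym (*-identityˡ _)) (*-monoˡ-≤ 6 (no-leaf i (lookup⇒[]= i F eq)))
    ...   | no ¬l = subst (12 ≤_) (sym (*-identityˡ _)) (*-monoˡ-≤ 4 (≰⇒> ¬l))

    total-charge : 12 * ∣ F ∣ ≤ ∑Fin n λ v → sh v * vertex-charge v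
    total-charge = begin
      12 * ∣ F ∣
        ≡⟨ cong (12 *_) (sym (∑Fin-𝟙 F)) ⟩
      12 * ∑Fin M 𝟙F
        ≡⟨ sym (*-distribˡ-∑ (List.allFin M) 12 𝟙F) ⟩
      ∑Fin M (λ i → 12 * 𝟙F i)
        ≤⟨ ∑-mono (List.allFin M) edge-charge ⟩
      ∑Fin M (λ i → 𝟙F i * (#shared i * charge i))
        ≡⟨ ∑-cong (List.allFin M) (λ i → trans (sym (*-assoc (𝟙F i) (#shared i) (charge i))) (spread i)) ⟩
      ∑Fin M (λ i → ∑Fin n λ v → sh v * (𝟙F i * incidence v i * charge i))
        ≡⟨ ∑-swap (List.allFin M) (List.allFin n) _ ⟩
      ∑Fin n (λ v → ∑Fin M λ i → sh v * (𝟙F i * incidence v i * charge i))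
        ≡⟨ ∑-cong (List.allFin n) (λ v → *-distribˡ-∑ (List.allFin M) (sh v) _) ⟩
      ∑Fin n (λ v → sh v * vertex-charge v) ∎
      where
      open ≤-Reasoning
      #shared≡ : ∀ i → #shared i ≡ ∑Fin n λ v → incidence v i * sh v
      #shared≡ i = trans (∑-cong (List.allFin r) λ p → sym (∑Fin-δ sh (at i p)))
        (trans (∑-swap (List.allFin r) (List.allFin n) _)
          (∑-cong (List.allFin n) λ v → *-distribʳ-∑ (List.allFin r) (sh v) _))
      rearrange : ∀ s f i c → f * c * (i * s) ≡ s * (f * i * c)
      rearrange = solve-∀
      rearrange′ : ∀ f s c → f * s * c ≡ f * c * s
      rearrange′ = solve-∀
      spread : ∀ i → 𝟙F i * #shared i * charge i ≡ ∑Fin n λ v → sh v * (𝟙F i * incidence v i * charge i)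
      spread i = trans (rearrange′ (𝟙F i) (#shared i) (charge i))
        (trans (cong (𝟙F i * charge i *_) (#shared≡ i))
        (trans (sym (*-distribˡ-∑ (List.allFin n) (𝟙F i * charge i) _))
          (∑-cong (List.allFin n) λ v → rearrange (sh v) (𝟙F i) (incidence v i) (charge i))))

    vertex-charge≡ : ∀ v → vertex-charge v ≡ 4 * degree v + 2 * light-incidences v
    vertex-charge≡ v = trans (∑-cong (List.allFin M) λ i → lemma (𝟙F i * incidence v i) (𝟙 ⌊ light? i ⌋))
      (trans (∑-distrib-+ (List.allFin M) _ _)
        (cong₂ _+_ (*-distribˡ-∑ (List.allFin M) 4 _) (*-distribˡ-∑ (List.allFin M) 2 _)))
      where
      lemma : ∀ a b → a * (4 + 2 * b) ≡ 4 * a + 2 * (a * b)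
      lemma = solve-∀

    light-incidences≤degree : ∀ v → light-incidences v ≤ degree v
    light-incidences≤degree v = ∑-mono (List.allFin M) λ i →
      ≤-trans (*-monoʳ-≤ (𝟙F i * incidence v i) (𝟙≤1 ⌊ light? i ⌋)) (≤-reflexive (*-identityʳ _))

    -- Two light incidences at `v` would lie either in one edge, against injectivity, or in two
    -- edges forming a `LightPath`.
    light-incidences≤1 : ∀ v → load v ≤ 2 → light-incidences v ≤ 1
    light-incidences≤1 v small = ∑Fin-≤1 M _ ≤1 unique
      where
      incidence≤1 : ∀ i → i ∈ₛ F → incidence v i ≤ 1
      incidence≤1 i i∈F = ∑Fin-≤1 r _ (λ p → 𝟙≤1 ⌊ at i p Fin.≟ v ⌋) λ p q hp hq →
        inj i i∈F p q (trans (𝟙>0 (at i p Fin.≟ v) hp) (sym (𝟙>0 (at i q Fin.≟ v) hq)))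
      ≤1 : ∀ i → 𝟙F i * incidence v i * 𝟙 ⌊ light? i ⌋ ≤ 1
      ≤1 i with lookup F i in eq
      ... | false = z≤n
      ... | true  = *-mono-≤ (subst (_≤ 1) (sym (*-identityˡ _)) (incidence≤1 i (lookup⇒[]= i F eq))) (𝟙≤1 ⌊ light? i ⌋)
      unique : ∀ i j → 0 < 𝟙F i * incidence v i * 𝟙 ⌊ light? i ⌋ → 0 < 𝟙F j * incidence v j * 𝟙 ⌊ light? j ⌋ → i ≡ j
      unique i j hi hj with j Fin.≟ i
      ... | yes j≡i = sym j≡i
      ... | no  j≢i = contradiction
        ( 𝟙F>0 (0<m*n⇒0<m (𝟙F i) (0<m*n⇒0<m _ hi)) , 𝟙F>0 (0<m*n⇒0<m (𝟙F j) (0<m*n⇒0<m _ hj)) , j≢i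
        , 𝟙>0 (light? i) (0<m*n⇒0<n (𝟙F i * incidence v i) hi) , 𝟙>0 (light? j) (0<m*n⇒0<n (𝟙F j * incidence v j) hj)
        , trans (proj₂ pi) (sym (proj₂ pj)) , subst (λ u → load u ≤ 2) (sym (proj₂ pi)) small)
        (no-path i j (proj₁ pi) (proj₁ pj))
        where
        pi = incident⁻¹ (0<m*n⇒0<n (𝟙F i) (0<m*n⇒0<m _ hi))
        pj = incident⁻¹ (0<m*n⇒0<n (𝟙F j) (0<m*n⇒0<m _ hj))

    vertex-bound : ∀ v → sh v * vertex-charge v + 10 * 𝟙 (lookup covered v) ≤ 10 * load v
    vertex-bound v = begin
      sh v * vertex-charge v + 10 * 𝟙 (lookup covered v)
        ≡⟨ cong₂ (λ x b → sh v * x + 10 * 𝟙 b) (vertex-charge≡ v) (lookup∘tabulate _ v) ⟩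
      sh v * (4 * degree v + 2 * light-incidences v) + 10 * 𝟙 ⌊ 1 ≤? degree v ⌋
        ≤⟨ vertex-payment (degree v) (light-incidences v) (lookup X v) (1 ≤? degree v) (shared? v)
             (light-incidences≤degree v) (light-incidences≤1 v) ⟩
      10 * load v ∎
      where open ≤-Reasoning

    -- The discharging total: the edges collect at least `12 * ∣ F ∣` while every covered vertex
    -- keeps 10 of its `10 * load v`.
    irreducible-dense : 12 * ∣ F ∣ + 10 * ∣ covered ∣ ≤ 10 * (r * ∣ F ∣) + 10 * ∣ X ∣
    irreducible-dense = begin
      12 * ∣ F ∣ + 10 * ∣ covered ∣
        ≤⟨ +-mono-≤ total-charge (≤-reflexive (cong (10 *_) (sym (∑Fin-𝟙 covered)))) ⟩
      ∑Fin n (λ v → sh v * vertex-charge v) + 10 * ∑Fin n (𝟙 ∘ lookup covered)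
        ≡⟨ cong (∑Fin n (λ v → sh v * vertex-charge v) +_) (sym (*-distribˡ-∑ (List.allFin n) 10 _)) ⟩
      ∑Fin n (λ v → sh v * vertex-charge v) + ∑Fin n (λ v → 10 * 𝟙 (lookup covered v))
        ≡⟨ sym (∑-distrib-+ (List.allFin n) _ _) ⟩
      ∑Fin n (λ v → sh v * vertex-charge v + 10 * 𝟙 (lookup covered v))
        ≤⟨ ∑-mono (List.allFin n) vertex-bound ⟩
      ∑Fin n (λ v → 10 * load v)
        ≡⟨ *-distribˡ-∑ (List.allFin n) 10 load ⟩
      10 * ∑Fin n load
        ≡⟨ cong (10 *_) (trans (∑-distrib-+ (List.allFin n) degree _) (cong₂ _+_ ∑-degree (∑Fin-𝟙 X))) ⟩
      10 * (r * ∣ F ∣ + ∣ X ∣)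
        ≡⟨ *-distribˡ-+ 10 (r * ∣ F ∣) ∣ X ∣ ⟩
      10 * (r * ∣ F ∣) + 10 * ∣ X ∣ ∎
      where open ≤-Reasoning

  -- `irreducible-dense` and sparsity differ by 12 - 11 = 1 per edge, so an irreducible `F` would
  -- satisfy `∣ F ∣ < 10 * ∣ X ∣`.
  sparse⇒reducible : ∀ J → Sparse J H → 2 ≤ r → 0 < ∣ F ∣ → ∣ F ∣ ≤ J → 10 * ∣ X ∣ ≤ ∣ F ∣ → Reducible
  sparse⇒reducible J sparse r≥2 F>0 F≤J X≤F = find-degenerate
    (Fin.any? λ i → (i ∈? F) ×-dec ¬? (Inj? (lookup H i)))
    where
    open ≤-Reasoning
    lemma : ∀ f c → 11 * f + 10 * c + f ≡ 12 * f + 10 * c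
    lemma = solve-∀
    module _ (inj : ∀ i → i ∈ₛ F → Inj (lookup H i)) where
      find-path : (∀ i → i ∈ₛ F → 2 ≤ #shared i) →
                  Dec (∃ λ i → ∃ λ j → ∃ λ p → ∃ λ q → LightPath i j p q) → Reducible
      find-path _       (yes (i , j , p , q , lp)) = lightPath⇒reducible r≥2 inj lp
      find-path no-leaf (no none) = contradiction X≤F (<⇒≱ (+-cancelˡ-< (11 * ∣ F ∣ + 10 * ∣ covered ∣) _ _ (begin-strict
        11 * ∣ F ∣ + 10 * ∣ covered ∣ + ∣ F ∣             ≡⟨ lemma ∣ F ∣ ∣ covered ∣ ⟩
        12 * ∣ F ∣ + 10 * ∣ covered ∣                     ≤⟨ irreducible-dense inj no-leaf
                                                              (λ i j p q lp → none (i , j , p , q , lp)) ⟩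
        10 * (r * ∣ F ∣) + 10 * ∣ X ∣                     <⟨ +-monoˡ-< (10 * ∣ X ∣) (sparse F covered covered-⊇ F>0 F≤J) ⟩
        10 * ∣ covered ∣ + 11 * ∣ F ∣ + 10 * ∣ X ∣        ≡⟨ cong (_+ 10 * ∣ X ∣) (+-comm (10 * ∣ covered ∣) (11 * ∣ F ∣)) ⟩
        11 * ∣ F ∣ + 10 * ∣ covered ∣ + 10 * ∣ X ∣        ∎)))

      find-leaf : Dec (∃ λ i → i ∈ₛ F × #shared i ≤ 1) → Reducible
      find-leaf (yes (i , i∈F , few)) =
        let p , rest = count≤1 (λ p → shared? (at i p)) (<⇒≤ r≥2) few
        in leaf i p i∈F (inj i i∈F) λ q q≢p → unshared⇒only₁ q i∈F (rest q q≢p)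
      find-leaf (no none) = find-path (λ i i∈F → ≰⇒> λ few → none (i , i∈F , few))
        (Fin.any? λ i → Fin.any? λ j → Fin.any? λ p → Fin.any? λ q → lightPath? i j p q)

    find-degenerate : Dec (∃ λ i → i ∈ₛ F × ¬ Inj (lookup H i)) → Reducible
    find-degenerate (yes (i , i∈F , ¬inj)) = degenerate i i∈F ¬inj
    find-degenerate (no none) = find-leaf
      (λ i i∈F → decidable-stable (Inj? (lookup H i)) λ ¬inj → none (i , i∈F , ¬inj))
      (Fin.any? λ i → (i ∈? F) ×-dec (#shared i ≤? 1))

-- Extending partial solutions

lookup-ext : ∀ {u v : Vec A n} → (∀ i → lookup u i ≡ lookup v i) → u ≡ v
lookup-ext {u = u} {v} e = trans (sym (tabulate∘lookup u)) (trans (tabulate-cong e) (tabulate∘lookup v))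

anyVec? : ∀ {P : Vec (Fin s) n → Set} → Decidable P → Dec (∃ P)
anyVec? {n = zero}  P? = map′ ([] ,_) (λ { ([] , p) → p }) (P? [])
anyVec? {n = suc n} P? = map′ (λ { (x , v , p) → x ∷ v , p }) (λ { (x ∷ v , p) → x , v , p })
  (Fin.any? λ x → anyVec? λ v → P? (x ∷ v))

⋃-bounded : ∀ s κ (G : Fin s → Subset M) → (∀ c → ∣ G c ∣ ≤ κ) → ∃ λ U → (∀ c → G c ⊆ U) × ∣ U ∣ ≤ s * κ
⋃-bounded {M} zero    κ G G≤κ = ∅ , (λ ()) , ≤-reflexive (∣⊥∣≡0 M)
⋃-bounded     (suc s) κ G G≤κ with ⋃-bounded s κ (G ∘ suc) (G≤κ ∘ suc)
... | U , G⊆U , U≤ = G zero ∪ U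
  , (λ { zero → p⊆p∪q U ; (suc c) → q⊆p∪q (G zero) U ∘ G⊆U c })
  , ≤-trans (∣p∪q∣≤∣p∣+∣q∣ (G zero) U) (+-mono-≤ (G≤κ zero) U≤)

dom : (Fin n → Maybe (Fin s)) → Subset n
dom h = tabulate (is-just ∘ h)

∈-dom : ∀ (h : Fin n → Maybe (Fin s)) {v c} → h v ≡ just c → v ∈ₛ dom h
∈-dom h {v} e = lookup⇒[]= v (dom h) (trans (lookup∘tabulate (is-just ∘ h) v) (cong is-just e))

dom-⊆ : ∀ (g h : Fin n → Maybe (Fin s)) → (∀ v → g v ≡ nothing ⊎ g v ≡ h v) → dom g ⊆ dom h
dom-⊆ g h g≼h {v} v∈g with g v | trans (sym (lookup∘tabulate (is-just ∘ g) v)) ([]=⇒lookup v∈g) | g≼h v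
... | just c | _ | inj₂ e = ∈-dom h (sym e)

assign : (Fin n → Maybe (Fin s)) → Fin n → Fin s → Fin n → Maybe (Fin s)
assign h x c v = if ⌊ v Fin.≟ x ⌋ then just c else h v

assign-hit : ∀ (h : Fin n → Maybe (Fin s)) x c → assign h x c x ≡ just c
assign-hit h x c with x Fin.≟ x
... | yes _ = refl
... | no ¬e = contradiction refl ¬e

assign-miss : ∀ (h : Fin n → Maybe (Fin s)) {x} c {v} → v ≢ x → assign h x c v ≡ h v
assign-miss h {x} c {v} v≢x with v Fin.≟ x
... | yes e = contradiction e v≢x
... | no _  = refl

∣dom-assign∣ : ∀ (h : Fin n → Maybe (Fin s)) x c → ∣ dom (assign h x c) ∣ ≤ suc ∣ dom h ∣
∣dom-assign∣ h x c = ≤-trans (p⊆q⇒∣p∣≤∣q∣ sub) (≤-trans (∣p∪q∣≤∣p∣+∣q∣ ⁅ x ⁆ (dom h))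
    (≤-reflexive (cong (_+ ∣ dom h ∣) (∣⁅x⁆∣≡1 x))))
  where
  sub : dom (assign h x c) ⊆ ⁅ x ⁆ ∪ dom h
  sub {v} v∈ with v Fin.≟ x
  ... | yes refl = x∈p∪q⁺ (inj₁ (x∈⁅x⁆ x))
  ... | no  v≢x  = x∈p∪q⁺ (inj₂ (lookup⇒[]= v (dom h) (trans (lookup∘tabulate (is-just ∘ h) v)
          (trans (cong is-just (sym (assign-miss h c v≢x)))
          (trans (sym (lookup∘tabulate (is-just ∘ assign h x c) v)) ([]=⇒lookup v∈))))))

module _ (g : Vec (Fin s) n) (e : Edge n r) (t : Vec (Fin s) r) (p : Fin r) where

  private
    hit? : ∀ v → Dec (∃ λ q → q ≢ p × lookup e q ≡ v)
    hit? v = Fin.any? λ q → ¬? (q Fin.≟ p) ×-dec (lookup e q Fin.≟ v)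

    value : ∀ {v} → Dec (∃ λ q → q ≢ p × lookup e q ≡ v) → Fin s
    value     (yes (q , _)) = lookup t q
    value {v} (no _)        = lookup g v

  -- Position `p` is spared: it is where the edge is attached to the rest, and its value has to
  -- survive.
  override : Vec (Fin s) n
  override = tabulate λ v → value (hit? v)

  override-hit : Inj e → ∀ q → q ≢ p → lookup override (lookup e q) ≡ lookup t q
  override-hit inj q q≢p = trans (lookup∘tabulate _ (lookup e q)) (go (hit? (lookup e q)))
    where
    go : (d : Dec (∃ λ q′ → q′ ≢ p × lookup e q′ ≡ lookup e q)) → value d ≡ lookup t q
    go (yes (q′ , _ , e′)) = cong (lookup t) (inj q′ q e′)
    go (no none)           = contradiction (q , q≢p , refl) none

  override-miss : ∀ v → (∀ q → q ≢ p → lookup e q ≢ v) → lookup override v ≡ lookup g v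
  override-miss v miss = trans (lookup∘tabulate _ v) (go (hit? v))
    where
    go : (d : Dec (∃ λ q′ → q′ ≢ p × lookup e q′ ≡ v)) → value d ≡ lookup g v
    go (yes (q , q≢p , e′)) = contradiction e′ (miss q q≢p)
    go (no _)               = refl

  override-tuple : Inj e → lookup t p ≡ lookup g (lookup e p) → map (lookup override) e ≡ t
  override-tuple inj tp = lookup-ext λ q → trans (lookup-map q (lookup override) e) (at-q q)
    where
    at-q : ∀ q → lookup override (lookup e q) ≡ lookup t q
    at-q q with q Fin.≟ p
    ... | no q≢p = override-hit inj q q≢p
    ... | yes refl = trans (override-miss _ λ q′ q′≢p e′ → q′≢p (inj q′ q e′)) (sym tp)

  override-other : ∀ {r′} (e′ : Edge n r′) → (∀ x q → q ≢ p → lookup e q ≢ lookup e′ x) →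
                   map (lookup override) e′ ≡ map (lookup g) e′
  override-other e′ miss = lookup-ext λ x → trans (lookup-map x (lookup override) e′)
    (trans (override-miss (lookup e′ x) (miss x)) (sym (lookup-map x (lookup g) e′)))

Agrees : (Fin n → Maybe (Fin s)) → Vec (Fin s) n → Set
Agrees h g = ∀ v → h v ≡ nothing ⊎ h v ≡ just (lookup g v)

override-agrees : ∀ (h : Fin n → Maybe (Fin s)) g (e : Edge n r) t p → Agrees h g →
  (∀ q → q ≢ p → ¬ lookup e q ∈ₛ dom h) → Agrees h (override g e t p)
override-agrees h g e t p agrees avoids v with agrees v
... | inj₁ nothing≡ = inj₁ nothing≡
... | inj₂ just≡    = inj₂ (trans just≡ (cong just (sym (override-miss g e t p v λ q q≢p e′ →
        avoids q q≢p (subst (_∈ₛ dom h) (sym e′) (∈-dom h just≡))))))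

-- The hypothesis on compositions as solutions use it: any values at the two far ends of a path of
-- two edges can be joined through the common vertex.
TwoStep : (Vec (Fin s) r → Set) → Set
TwoStep {s} {r} P = ∀ (p p′ q q′ : Fin r) → p′ ≢ p → q′ ≢ q → ∀ (a b : Fin s) →
  ∃ λ t → ∃ λ t′ → P t × P t′ × lookup t p′ ≡ a × lookup t p ≡ lookup t′ q × lookup t′ q′ ≡ b

module _ (H : Hypergraph n r M) (P : Vec (Fin s) r → Set) where

  private
    at : Fin M → Fin r → Fin n
    at i p = lookup (lookup H i) p

  Solves : Subset M → Vec (Fin s) n → Set
  Solves F g = ∀ i → i ∈ₛ F → Inj (lookup H i) → P (map (lookup g) (lookup H i))

  Solvable : Subset M → (Fin n → Maybe (Fin s)) → Set
  Solvable F h = ∃ λ g → Agrees h g × Solves F g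

  -- Exhaustive search over total assignments. It makes the argument by contradiction in
  -- `locallySolvable-extends` constructive.
  solvable? : Decidable P → ∀ F h → Dec (Solvable F h)
  solvable? P? F h = anyVec? λ g →
    Fin.all? (λ v → Maybe.≡-dec Fin._≟_ (h v) nothing ⊎-dec Maybe.≡-dec Fin._≟_ (h v) (just (lookup g v)))
    ×-dec Fin.all? (λ i → (i ∈? F) →-dec Inj? (lookup H i) →-dec P? (map (lookup g) (lookup H i)))

  solvable-≼ : ∀ {F} {h h′ : Fin n → Maybe (Fin s)} → (∀ v → h′ v ≡ nothing ⊎ h′ v ≡ h v) → Solvable F h → Solvable F h′
  solvable-≼ {h = h} {h′} h′≼h (g , agrees , solves) = g , agrees′ , solves
    where
    agrees′ : Agrees h′ g
    agrees′ v with h′≼h v | agrees v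
    ... | inj₁ e | _       = inj₁ e
    ... | inj₂ e | inj₁ e′ = inj₁ (trans e e′)
    ... | inj₂ e | inj₂ e′ = inj₂ (trans e e′)

  module _ (r≥2 : 2 ≤ r) (two-step : TwoStep P) (F : Subset M) (h : Fin n → Maybe (Fin s)) where

    -- A full composition forces its first factor to be total, so every element occurs at every
    -- position of some tuple. This suffices for a leaf.
    through : ∀ p a → ∃ λ t → P t × lookup t p ≡ a
    through p a with another r≥2 p
    ... | q , q≢p with two-step q p q p (≢-sym q≢p) (≢-sym q≢p) a a
    ...   | t , _ , Pt , _ , tp , _ = t , Pt , tp

    solvable-degenerate : ∀ i → ¬ Inj (lookup H i) → Solvable (F - i) h → Solvable F h
    solvable-degenerate i ¬inj (g , agrees , solves) = g , agrees , solves′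
      where
      solves′ : Solves F g
      solves′ k k∈F inj with k Fin.≟ i
      ... | yes refl = contradiction inj ¬inj
      ... | no  k≢i  = solves k (x∈p∧x≢y⇒x∈p-y k∈F k≢i) inj

    solvable-leaf : ∀ i p → Inj (lookup H i) → (∀ q → q ≢ p → Only₁ H (dom h) F i (at i q)) →
                    Solvable (F - i) h → Solvable F h
    solvable-leaf i p inj only (g , agrees , solves) =
      g′ , override-agrees h g (lookup H i) t p agrees (λ q q≢p → proj₁ (only q q≢p)) , solves′
      where
      t  = proj₁ (through p (lookup g (at i p)))
      Pt = proj₁ (proj₂ (through p (lookup g (at i p))))
      tp = proj₂ (proj₂ (through p (lookup g (at i p))))
      g′ = override g (lookup H i) t p
      solves′ : Solves F g′
      solves′ k k∈F injₖ with k Fin.≟ i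
      ... | yes refl = subst P (sym (override-tuple g (lookup H i) t p inj tp)) Pt
      ... | no  k≢i  = subst P (sym (override-other g (lookup H i) t p (lookup H k) λ x q q≢p e →
                         proj₂ (only q q≢p) k x k∈F k≢i (sym e)))
                       (solves k (x∈p∧x≢y⇒x∈p-y k∈F k≢i) injₖ)

    -- Edge `i` is rewritten first and `j` second. The first rewriting leaves the attachment of `j`
    -- alone; the second meets the rewritten part of `i` only in the common vertex, on whose value
    -- `t` and `t′` agree.
    solvable-path : ∀ i j p p′ q q′ → i ∈ₛ F → j ∈ₛ F → i ≢ j → Inj (lookup H i) → Inj (lookup H j) →
      p′ ≢ p → q′ ≢ q → at i p ≡ at j q → Only₂ H (dom h) F i j (at i p) →
      (∀ x → x ≢ p → x ≢ p′ → Only₁ H (dom h) F i (at i x)) →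
      (∀ x → x ≢ q → x ≢ q′ → Only₁ H (dom h) F j (at j x)) →
      Solvable (F - i - j) h → Solvable F h
    solvable-path i j p p′ q q′ i∈F j∈F i≢j injᵢ injⱼ p′≢p q′≢q joint only₂ onlyᵢ onlyⱼ (g , agrees , solves)
      with two-step p p′ q q′ p′≢p q′≢q (lookup g (at i p′)) (lookup g (at j q′))
    ... | t , t′ , Pt , Pt′ , tp′ , tp≡t′q , t′q′ =
      g₂ , override-agrees h g₁ (lookup H j) t′ q′ (override-agrees h g (lookup H i) t p′ agrees outsideᵢ) outsideⱼ , solves₂
      where
      g₁ = override g (lookup H i) t p′
      g₂ = override g₁ (lookup H j) t′ q′
      outsideᵢ : ∀ x → x ≢ p′ → ¬ at i x ∈ₛ dom h
      outsideᵢ x x≢p′ with x Fin.≟ p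
      ... | yes refl = proj₁ only₂
      ... | no  x≢p  = proj₁ (onlyᵢ x x≢p x≢p′)
      outsideⱼ : ∀ x → x ≢ q′ → ¬ at j x ∈ₛ dom h
      outsideⱼ x x≢q′ with x Fin.≟ q
      ... | yes refl = subst (λ v → ¬ v ∈ₛ dom h) joint (proj₁ only₂)
      ... | no  x≢q  = proj₁ (onlyⱼ x x≢q x≢q′)
      missᵢ : ∀ k y → k ∈ₛ F → k ≢ i → k ≢ j → ∀ x → x ≢ p′ → at i x ≢ at k y
      missᵢ k y k∈F k≢i k≢j x x≢p′ e with x Fin.≟ p
      ... | yes refl = proj₂ only₂ k y k∈F k≢i k≢j (sym e)
      ... | no  x≢p  = proj₂ (onlyᵢ x x≢p x≢p′) k y k∈F k≢i (sym e)
      missⱼ : ∀ k y → k ∈ₛ F → k ≢ i → k ≢ j → ∀ x → x ≢ q′ → at j x ≢ at k y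
      missⱼ k y k∈F k≢i k≢j x x≢q′ e with x Fin.≟ q
      ... | yes refl = proj₂ only₂ k y k∈F k≢i k≢j (sym (trans joint e))
      ... | no  x≢q  = proj₂ (onlyⱼ x x≢q x≢q′) k y k∈F k≢j (sym e)
      q′-free : ∀ x → x ≢ p′ → at i x ≢ at j q′
      q′-free x x≢p′ e with x Fin.≟ p
      ... | yes refl = q′≢q (injⱼ q′ q (sym (trans (sym joint) e)))
      ... | no  x≢p  = proj₂ (onlyᵢ x x≢p x≢p′) j q′ j∈F (≢-sym i≢j) (sym e)
      i-free : ∀ x → x ≢ p → ∀ y → y ≢ q′ → at j y ≢ at i x
      i-free x x≢p y y≢q′ e with y Fin.≟ q
      ... | yes refl = x≢p (injᵢ x p (sym (trans joint e)))
      ... | no  y≢q  = proj₂ (onlyⱼ y y≢q y≢q′) i x i∈F i≢j (sym e)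
      tuple₁ : map (lookup g₁) (lookup H i) ≡ t
      tuple₁ = override-tuple g (lookup H i) t p′ injᵢ tp′
      tupleⱼ : map (lookup g₂) (lookup H j) ≡ t′
      tupleⱼ = override-tuple g₁ (lookup H j) t′ q′ injⱼ
        (trans t′q′ (sym (override-miss g (lookup H i) t p′ (at j q′) q′-free)))
      at-x : ∀ x → lookup g₂ (at i x) ≡ lookup t x
      at-x x with x Fin.≟ p
      ... | yes refl = trans (cong (lookup g₂) joint)
                         (trans (override-hit g₁ (lookup H j) t′ q′ injⱼ q (≢-sym q′≢q)) (sym tp≡t′q))
      ... | no  x≢p  = trans (override-miss g₁ (lookup H j) t′ q′ (at i x) (i-free x x≢p))
                         (trans (sym (lookup-map x (lookup g₁) (lookup H i))) (cong (λ u → lookup u x) tuple₁))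
      tupleᵢ : map (lookup g₂) (lookup H i) ≡ t
      tupleᵢ = lookup-ext λ x → trans (lookup-map x (lookup g₂) (lookup H i)) (at-x x)
      solves₂ : Solves F g₂
      solves₂ k k∈F injₖ with k Fin.≟ i | k Fin.≟ j
      ... | yes refl | _        = subst P (sym tupleᵢ) Pt
      ... | no  _    | yes refl = subst P (sym tupleⱼ) Pt′
      ... | no  k≢i  | no  k≢j  = subst P
        (sym (trans (override-other g₁ (lookup H j) t′ q′ (lookup H k) (λ y → missⱼ k y k∈F k≢i k≢j))
                    (override-other g  (lookup H i) t  p′ (lookup H k) (λ y → missᵢ k y k∈F k≢i k≢j))))
        (solves k (x∈p∧x≢y⇒x∈p-y (x∈p∧x≢y⇒x∈p-y k∈F k≢i) k≢j) injₖ)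

  -- Removing pendant pieces one at a time reduces every set of at most J edges to one of size 10 |dom h|.
  solvable-grows : 2 ≤ r → TwoStep P → ∀ J → Sparse J H → ∀ h →
    (∀ F → ∣ F ∣ ≤ 10 * ∣ dom h ∣ → Solvable F h) → ∀ F → ∣ F ∣ ≤ J → Solvable F h
  solvable-grows r≥2 two-step J sparse h small F = go ∣ F ∣ F ≤-refl
    where
    go : ∀ m F → ∣ F ∣ ≤ m → ∣ F ∣ ≤ J → Solvable F h
    go zero    F F≤m F≤J = small F (≤-trans F≤m z≤n)
    go (suc m) F F≤m F≤J with ∣ F ∣ ≤? 10 * ∣ dom h ∣
    ... | yes F≤ = small F F≤
    ... | no  F≰ = reduce (sparse⇒reducible H (dom h) F J sparse r≥2 (≤-trans z<s F>) F≤J (<⇒≤ F>))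
      where
      F> : 10 * ∣ dom h ∣ < ∣ F ∣
      F> = ≰⇒> F≰
      fewer : ∀ {i} → i ∈ₛ F → ∣ F - i ∣ ≤ m
      fewer i∈F = ≤-pred (≤-trans (x∈p⇒∣p-x∣<∣p∣ i∈F) F≤m)
      within-J : ∀ i → ∣ F - i ∣ ≤ J
      within-J i = ≤-trans (∣p─q∣≤∣p∣ F ⁅ i ⁆) F≤J
      reduce : Reducible H (dom h) F → Solvable F h
      reduce (degenerate i i∈F ¬inj) = solvable-degenerate r≥2 two-step F h i ¬inj (go m (F - i) (fewer i∈F) (within-J i))
      reduce (leaf i p i∈F inj only) = solvable-leaf r≥2 two-step F h i p inj only (go m (F - i) (fewer i∈F) (within-J i))
      reduce (path i j p p′ q q′ i∈F j∈F i≢j injᵢ injⱼ p′≢p q′≢q joint only₂ onlyᵢ onlyⱼ) =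
        solvable-path r≥2 two-step F h i j p p′ q q′ i∈F j∈F i≢j injᵢ injⱼ p′≢p q′≢q joint only₂ onlyᵢ onlyⱼ
          (go m (F - i - j) (≤-trans (∣p─q∣≤∣p∣ (F - i) ⁅ j ⁆) (fewer i∈F))
                            (≤-trans (∣p─q∣≤∣p∣ (F - i) ⁅ j ⁆) (within-J i)))

  -- The bound covers the `10 * ∣ dom h ∣` edges from which `solvable-grows` starts; `suc` keeps it
  -- positive, so that single edges are controlled even for `k = 0`.
  LocallySolvable : ℕ → (Fin n → Maybe (Fin s)) → Set
  LocallySolvable k h = ∣ dom h ∣ ≤ k × (∀ F → ∣ F ∣ ≤ 10 * suc k → Solvable F h)

  -- If each value `c` at `x` fails on a set of at most `10 * suc k` edges, the union of the `s`
  -- sets is still in the sparse range. A solution `g` of the union then contradicts the failure of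
  -- the value `lookup g x`.
  locallySolvable-extends : Decidable P → 2 ≤ r → TwoStep P → ∀ k → Sparse (s * (10 * suc k)) H →
    ∀ h → LocallySolvable k h → ∣ dom h ∣ < k → ∀ x → h x ≡ nothing → ∃ λ c → LocallySolvable k (assign h x c)
  locallySolvable-extends P? r≥2 two-step k sparse h (h≤k , local) h<k x hx≡nothing =
    decide (Fin.any? λ c → ¬? (anySubset? (λ F → bad? c F)))
    where
    κ = 10 * suc k
    Bad : Fin s → Subset M → Set
    Bad c F = ∣ F ∣ ≤ κ × ¬ Solvable F (assign h x c)
    bad? : ∀ c F → Dec (Bad c F)
    bad? c F = (∣ F ∣ ≤? κ) ×-dec ¬? (solvable? P? F (assign h x c))
    agrees-assign : ∀ g → Agrees h g → Agrees (assign h x (lookup g x)) g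
    agrees-assign g agrees v with v Fin.≟ x
    ... | yes refl = inj₂ refl
    ... | no  _    = agrees v
    decide : Dec (∃ λ c → ¬ ∃ (Bad c)) → ∃ λ c → LocallySolvable k (assign h x c)
    decide (yes (c , good)) = c , ≤-trans (∣dom-assign∣ h x c) h<k , λ F F≤κ →
      decidable-stable (solvable? P? F (assign h x c)) λ ¬sol → good (F , F≤κ , ¬sol)
    decide (no all-bad) = contradiction refuted λ ()
      where
      bad : ∀ c → ∃ (Bad c)
      bad c = decidable-stable (anySubset? (bad? c)) λ good → all-bad (c , good)
      U = ⋃-bounded s κ (proj₁ ∘ bad) (proj₁ ∘ proj₂ ∘ bad)
      small : ∀ F → ∣ F ∣ ≤ 10 * ∣ dom h ∣ → Solvable F h
      small F F≤ = local F (≤-trans F≤ (*-monoʳ-≤ 10 (≤-trans h≤k (n≤1+n k))))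
      refuted : ⊥
      refuted with solvable-grows r≥2 two-step (s * κ) sparse h small (proj₁ U) (proj₂ (proj₂ U))
      ... | g , agrees , solves = proj₂ (proj₂ (bad (lookup g x)))
        (g , agrees-assign g agrees , λ i i∈ → solves i (proj₁ (proj₂ U) (lookup g x) i∈))

-- The instance of a hypergraph

∣p∣≤0⇒∉ : ∀ {p : Subset n} {i} → ∣ p ∣ ≤ 0 → ¬ i ∈ₛ p
∣p∣≤0⇒∉ p≤0 i∈p = n≮0 (≤-trans (x∈p⇒∣p-x∣<∣p∣ i∈p) p≤0)

fibre : (Fin n → Fin k) → Fin k → Subset n
fibre f c = tabulate λ v → ⌊ f v Fin.≟ c ⌋

∈-fibre⁻ : ∀ (f : Fin n → Fin k) c {v} → v ∈ₛ fibre f c → f v ≡ c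
∈-fibre⁻ f c {v} v∈ with f v Fin.≟ c | trans (sym (lookup∘tabulate (λ v → ⌊ f v Fin.≟ c ⌋) v)) ([]=⇒lookup v∈)
... | yes e | _ = e

large-fibre : ∀ t a (f : Fin (t * a) → Fin t) → 0 < t → ∃ λ c → a ≤ ∣ fibre f c ∣
large-fibre t a f t>0 = decidable-stable (Fin.any? λ c → a ≤? ∣ fibre f c ∣) λ none →
  <⇒≱ (m<n+m N t>0) (begin
    t + N                                       ≡⟨ cong₂ _+_ (sym (trans (∑Fin-const t 1) (*-identityʳ t))) N≡ ⟩
    ∑Fin t (λ _ → 1) + ∑Fin t (λ c → ∣ fibre f c ∣)  ≡⟨ sym (∑-distrib-+ (List.allFin t) (λ _ → 1) (λ c → ∣ fibre f c ∣)) ⟩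
    ∑Fin t (λ c → suc ∣ fibre f c ∣)            ≤⟨ ∑-mono (List.allFin t) (λ c → ≰⇒> (λ a≤ → none (c , a≤))) ⟩
    ∑Fin t (λ _ → a)                            ≡⟨ ∑Fin-const t a ⟩
    N                                           ∎)
  where
  open ≤-Reasoning
  N : ℕ
  N = t * a
  N≡ : N ≡ ∑Fin t (λ c → ∣ fibre f c ∣)
  N≡ = trans (sym (trans (∑Fin-const N 1) (*-identityʳ N)))
    (trans (∑-cong (List.allFin N) λ v → sym (∑Fin-δ (λ _ → 1) (f v)))
    (trans (∑-swap (List.allFin N) (List.allFin t) _)
      (∑-cong (List.allFin t) λ c → trans (∑-cong (List.allFin N) λ v →
        trans (*-identityʳ (𝟙 ⌊ f v Fin.≟ c ⌋)) (cong 𝟙 (sym (lookup∘tabulate (λ v → ⌊ f v Fin.≟ c ⌋) v))))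
        (∑Fin-𝟙 (fibre f c)))))

∣tabulate∣ : (f : Fin n → Bool) → Vec.sum (tabulate (λ i → if f i then 1 else 0)) ≡ ∣ tabulate f ∣
∣tabulate∣ {zero}  f = refl
∣tabulate∣ {suc n} f with f zero
... | true  = cong suc (∣tabulate∣ (f ∘ suc))
... | false = ∣tabulate∣ (f ∘ suc)

record Enumeration (A : Set) : Set where
  field
    size    : ℕ
    index   : A → Fin size
    element : Fin size → A
    element-index : ∀ a → element (index a) ≡ a
    index-element : ∀ i → index (element i) ≡ i

-- Flattens symbols and positions to the coordinates of one relation. `element-index` recovers the
-- components of a concatenated tuple, `index-element` keeps distinct coordinates distinct.
enumerate-Σ : ∀ m (ar : Fin m → ℕ) → Enumeration (Σ (Fin m) (Fin ∘ ar))
enumerate-Σ zero    ar = record { size = 0 ; index = λ () ; element = λ () ; element-index = λ () ; index-element = λ () }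
enumerate-Σ (suc m) ar = record
  { size = a + E.size ; index = index ; element = element ; element-index = element-index ; index-element = index-element }
  where
  module E = Enumeration (enumerate-Σ m (ar ∘ suc))
  a = ar zero
  index : Σ (Fin (suc m)) (Fin ∘ ar) → Fin (a + E.size)
  index (zero  , j) = j ↑ˡ E.size
  index (suc R , j) = a ↑ʳ E.index (R , j)
  shift : Σ (Fin m) (Fin ∘ ar ∘ suc) → Σ (Fin (suc m)) (Fin ∘ ar)
  shift (R , j) = suc R , j
  split : Fin a ⊎ Fin E.size → Σ (Fin (suc m)) (Fin ∘ ar)
  split (inj₁ j) = zero , j
  split (inj₂ y) = shift (E.element y)
  element : Fin (a + E.size) → Σ (Fin (suc m)) (Fin ∘ ar)
  element x = split (splitAt a x)
  element-index : ∀ p → element (index p) ≡ p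
  element-index (zero  , j) = cong split (Fin.splitAt-↑ˡ a j E.size)
  element-index (suc R , j) = trans (cong split (Fin.splitAt-↑ʳ a E.size (E.index (R , j))))
                                    (cong shift (E.element-index (R , j)))
  index-shift : ∀ p → index (shift p) ≡ a ↑ʳ E.index p
  index-shift _ = refl
  index-element : ∀ x → index (element x) ≡ x
  index-element x with splitAt a x in eq
  ... | inj₁ j = Fin.splitAt⁻¹-↑ˡ eq
  ... | inj₂ y = trans (index-shift (E.element y)) (trans (cong (a ↑ʳ_) (E.index-element y)) (Fin.splitAt⁻¹-↑ʳ eq))

-- The template as a single product relation

module Template {σ : Signature} (S T : Structure σ) where

  open Enumeration (enumerate-Σ (m σ) (ar σ)) public renaming (size to arity)

  component : ∀ {A : Set} (R : Fin (m σ)) → Vec A arity → Vec A (ar σ R)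
  component R u = tabulate λ j → lookup u (index (R , j))

  lookup-component : ∀ {A : Set} R (u : Vec A arity) j → lookup (component R u) j ≡ lookup u (index (R , j))
  lookup-component R u = lookup∘tabulate _

  map-component : ∀ {A B : Set} (f : A → B) R u → map f (component R u) ≡ component R (map f u)
  map-component f R u = lookup-ext λ j → trans (lookup-map j f (component R u))
    (trans (cong f (lookup-component R u j)) (trans (sym (lookup-map (index (R , j)) f u)) (sym (lookup-component R (map f u) j))))

  Product : Vec (Fin (size S)) arity → Set
  Product u = ∀ R → rel S R (component R u) ≡ true

  product? : Decidable Product
  product? u = Fin.all? λ R → rel S R (component R u) Bool.≟ true

  concatenate : ((R : Fin (m σ)) → Vec (Fin (size S)) (ar σ R)) → Vec (Fin (size S)) arity
  concatenate u = tabulate λ x → lookup (u (proj₁ (element x))) (proj₂ (element x))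

  component-concatenate : ∀ u R → component R (concatenate u) ≡ u R
  component-concatenate u R = lookup-ext λ j → trans (lookup-component R (concatenate u) j)
    (trans (lookup∘tabulate _ (index (R , j)))
      (cong (λ p → lookup (u (proj₁ p)) (proj₂ p)) (element-index (R , j))))

  product-twoStep : (∀ (i j : 𝒢Index {σ}) → IsFull (𝒢 S i ∘ᵣ 𝒢 S j)) → TwoStep Product
  product-twoStep full p p′ q q′ p′≢p q′≢q a b
    -- The pairs run from the far end to the common vertex and back out, so the intermediate element
    -- `c` is the value at the common vertex.
    with full ((element p′ , element p) , element-≢ p′≢p) ((element q , element q′) , element-≢ (≢-sym q′≢q)) a b
    where
    element-≢ : ∀ {x y} → x ≢ y → element x ≢ element y
    element-≢ {x} {y} x≢y e = x≢y (trans (sym (index-element x)) (trans (cong index e) (index-element y)))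
  ... | c , (u , u∈ , up′ , up) , (w , w∈ , wq , wq′) =
    concatenate u , concatenate w , in-product u u∈ , in-product w w∈ ,
    trans (lookup∘tabulate _ p′) up′ ,
    trans (lookup∘tabulate _ p) (trans up (sym (trans (lookup∘tabulate _ q) wq))) ,
    trans (lookup∘tabulate _ q′) wq′
    where
    in-product : ∀ u → InProduct S u → Product (concatenate u)
    in-product u u∈ R = subst (λ x → rel S R x ≡ true) (sym (component-concatenate u R)) (u∈ R)

  module _ {n M} (H : Hypergraph n arity M) where

    constraint? : ∀ R (a : Vec (Fin n) (ar σ R)) → Dec (∃ λ i → Inj (lookup H i) × a ≡ component R (lookup H i))
    constraint? R a = Fin.any? λ i → Inj? (lookup H i) ×-dec ≡-dec Fin._≟_ a (component R (lookup H i))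

    -- An edge imposes all symbols at once, each on its block of coordinates, so satisfying it in
    -- `S` amounts to lying in `Product`. A repeated vertex would force equal entries, which no
    -- tuple of `Product` need have; hence the restriction to `Inj`.
    instanceOf : Structure σ
    instanceOf = record { size = n ; rel = λ R a → ⌊ constraint? R a ⌋ }

    constraint⁻ : ∀ R a → rel instanceOf R a ≡ true → ∃ λ i → Inj (lookup H i) × a ≡ component R (lookup H i)
    constraint⁻ R a e with constraint? R a
    ... | yes c = c

    constraint⁺ : ∀ R i → Inj (lookup H i) → rel instanceOf R (component R (lookup H i)) ≡ true
    constraint⁺ R i inj with constraint? R (component R (lookup H i))
    ... | yes _ = refl
    ... | no ¬c = contradiction (i , inj , refl) ¬c

    domSize≡∣dom∣ : ∀ (h : PMap instanceOf S) → domSize {I = instanceOf} {S = S} h ≡ ∣ dom h ∣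
    domSize≡∣dom∣ h = trans (cong Vec.sum (sym (tabulate-allFin {n = n} (λ i → if is-just (h i) then 1 else 0)))) (∣tabulate∣ (is-just ∘ h))

    strategy : 0 < size S → 2 ≤ arity → TwoStep Product → ∀ k → Sparse (size S * (10 * suc k)) H →
               IsStrategy k instanceOf S (LocallySolvable H Product k)
    strategy s>0 r≥2 two-step k sparse = (∅h , nonempty) , partial-hom , restrict , extend
      where
      open ≤-Reasoning
      ∅h : PMap instanceOf S
      ∅h _ = nothing
      s₀ : Fin (size S)
      s₀ = fromℕ< s>0
      dom-∅ : ∣ dom ∅h ∣ ≡ 0
      dom-∅ = trans (sym (∑Fin-𝟙 (dom ∅h))) (trans (∑-cong (List.allFin n) λ v → cong 𝟙 (lookup∘tabulate (λ _ → false) v))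
                (∑-zero (List.allFin n)))
      trivial : ∀ F → ∣ F ∣ ≤ 10 * ∣ dom ∅h ∣ → Solvable H Product F ∅h
      trivial F F≤ = replicate n s₀ , (λ _ → inj₁ refl) , λ i i∈F →
        contradiction i∈F (∣p∣≤0⇒∉ (≤-trans F≤ (≤-reflexive (cong (10 *_) dom-∅))))
      -- Even the empty map has to be solvable on sets of up to `10 * suc k` edges; `solvable-grows`
      -- reaches them from the empty set of edges.
      nonempty : LocallySolvable H Product k ∅h
      nonempty = ≤-trans (≤-reflexive dom-∅) z≤n , λ F F≤ →
        solvable-grows H Product r≥2 two-step (size S * (10 * suc k)) sparse ∅h trivial F
          (≤-trans F≤ (m≤n*m (10 * suc k) (size S) {{>-nonZero s>0}}))

      partial-hom : ∀ h → LocallySolvable H Product k h → IsPartialHom instanceOf S h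
      partial-hom h (_ , local) R a b a∈R h∘a≡b with constraint⁻ R a a∈R
      -- A single edge is among the controlled sets, and its solution agrees with `h` on the block
      -- of `R`.
      ... | i , inj , refl with local ⁅ i ⁆ (≤-trans (≤-reflexive (∣⁅x⁆∣≡1 i)) (s≤s z≤n))
      ...   | g , agrees , solves = subst (λ u → rel S R u ≡ true) tuple (solves i (x∈⁅x⁆ i) inj R)
        where
        value : ∀ v c → h v ≡ just c → lookup g v ≡ c
        value v c e with agrees v
        ... | inj₁ e′ = contradiction (trans (sym e′) e) λ ()
        ... | inj₂ e′ = Maybe.just-injective (trans (sym e′) e)
        tuple : component R (map (lookup g) (lookup H i)) ≡ b
        tuple = trans (sym (map-component (lookup g) R (lookup H i))) (lookup-ext λ j →
          trans (lookup-map j (lookup g) (component R (lookup H i))) (value _ _ (h∘a≡b j)))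

      restrict : ∀ g h → LocallySolvable H Product k h → _≼_ {I = instanceOf} {S = S} g h → LocallySolvable H Product k g
      restrict g h (h≤k , local) g≼h = ≤-trans (p⊆q⇒∣p∣≤∣q∣ (dom-⊆ g h g≼h)) h≤k ,
        λ F F≤ → solvable-≼ H Product g≼h (local F F≤)

      extend : ∀ h → LocallySolvable H Product k h → domSize {I = instanceOf} {S = S} h < k → ∀ x → h x ≡ nothing →
        Σ (PMap instanceOf S) λ f → LocallySolvable H Product k f × (∃ λ c → f x ≡ just c) × (∀ i → i ≢ x → f i ≡ h i)
      extend h hℋ h<k x hx with locallySolvable-extends H Product product? r≥2 two-step k sparse h hℋ
                                  (subst (_< k) (domSize≡∣dom∣ h) h<k) x hx
      ... | c , fℋ = assign h x c , fℋ , (c , assign-hit h x c) , λ i i≢x → assign-miss h c i≢x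

    monochromatic : ∀ (f : Fin n → Fin (size T)) → IsHom instanceOf T f → ∀ i → Inj (lookup H i) →
                    ∀ c → (∀ p → f (lookup (lookup H i) p) ≡ c) → Reflexive T
    monochromatic f hom i inj c mono = c , λ R →
      subst (λ u → rel T R u ≡ true) (tuple R) (hom R (component R (lookup H i)) (constraint⁺ R i inj))
      where
      tuple : ∀ R → map f (component R (lookup H i)) ≡ replicate (ar σ R) c
      tuple R = lookup-ext λ j → trans (lookup-map j f (component R (lookup H i)))
        (trans (cong f (lookup-component R (lookup H i) j)) (trans (mono _) (sym (lookup-replicate j c))))

  reflexive-small-arity : S ⟶ T → 0 < size T → (∀ R → ∃ λ u → rel S R u ≡ true) → arity ≤ 1 → Reflexive T
  reflexive-small-arity (f , hom) t>0 nonempty r≤1 with constant arity r≤1 value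
    where
    u : ∀ R → Vec (Fin (size S)) (ar σ R)
    u R = proj₁ (nonempty R)
    value : Fin arity → Fin (size T)
    value x = f (lookup (u (proj₁ (element x))) (proj₂ (element x)))
    constant : ∀ r → r ≤ 1 → (v : Fin r → Fin (size T)) → ∃ λ c → ∀ x → v x ≡ c
    -- Without coordinates every symbol is nullary and any element of `T` serves.
    constant zero _ v = fromℕ< t>0 , λ ()
    constant (suc zero) _ v = v zero , λ { zero → refl }
    constant (suc (suc _)) (s≤s ()) v
  ... | c , value≡c = c , λ R → subst (λ w → rel T R w ≡ true)
    (lookup-ext λ j → trans (lookup-map j f (proj₁ (nonempty R)))
      (trans (sym (cong (λ p → f (lookup (proj₁ (nonempty (proj₁ p))) (proj₂ p))) (element-index (R , j))))
      (trans (value≡c (index (R , j))) (sym (lookup-replicate j c)))))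
    (hom R (proj₁ (nonempty R)) (proj₂ (nonempty R)))

  reflexive-large-arity : 0 < size S → 0 < size T → 2 ≤ arity → TwoStep Product → SublinearWidth S T → Reflexive T
  reflexive-large-arity s>0 t>0 r≥2 two-step (k , sublinear , width) = parameters (edge-density d)
    where
    open ≤-Reasoning
    c₀ d : ℕ
    -- The instance gets `c₀ * b` vertices, so there are exactly `suc d * b ^ arity` tuples and some
    -- colour class has at least `b + b` vertices.
    c₀ = 2 * size T
    d = pred (c₀ ^ arity)
    c₀^r : c₀ ^ arity ≡ suc d
    c₀^r = sym (suc-pred (c₀ ^ arity) {{m^n≢0 c₀ arity {{>-nonZero (*-mono-≤ (z<s {1}) t>0)}}}})
    parameters : (∃ λ C → 0 < C × 8 * d ^ C ≤ suc d ^ C) → Reflexive T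
    parameters (C , C>0 , dC) = large (sublinear (2 * L))
      where
      -- `sparsity arity C * J` equals `L * suc (k V)`. Sublinearity for the constant `2 * L` leaves
      -- half of `V` for the summand `L` that `suc` adds.
      L : ℕ
      L = sparsity arity C * (size S * 10)
      large : (∃ λ N → ∀ n → N ≤ n → 2 * L * k n ≤ n) → Reflexive T
      large (N , small) = build (∃-hypergraph V arity b d C J n>0 r≥2 r≤b C>0 n^r dC sparse-enough)
        where
        b V J : ℕ
        -- `N` makes sublinearity applicable at `V`, `2 * L` pays for the summand just mentioned,
        -- and `arity` gives room for distinct entries.
        b = N + (2 * L + arity)
        V = size T * (b + b)
        J = size S * (10 * suc (k V))
        r≤b : arity ≤ b
        r≤b = ≤-trans (m≤n+m arity (2 * L)) (m≤n+m _ N)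
        b≤n : b ≤ V
        b≤n = ≤-trans (m≤m+n b b) (m≤n*m (b + b) (size T) {{>-nonZero t>0}})
        n>0 : 0 < V
        n>0 = ≤-trans (<⇒≤ r≥2) (≤-trans r≤b b≤n)
        n^r : V ^ arity ≡ suc d * b ^ arity
        n^r = trans (cong (_^ arity) (double (size T) b)) (trans (^-distribʳ-* c₀ b arity) (cong (_* b ^ arity) c₀^r))
          where
          double : ∀ t b → t * (b + b) ≡ 2 * t * b
          double = solve-∀
        sparse-enough : sparsity arity C * J ≤ V
        sparse-enough = *-cancelˡ-≤ 2 (begin
          2 * (sparsity arity C * J)                        ≡⟨ lemma (sparsity arity C) (size S) (k V) ⟩
          2 * L * k V + 2 * L                           ≤⟨ +-mono-≤ (small V (≤-trans (m≤m+n N _) b≤n)) 2L≤n ⟩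
          V + V                                         ≡⟨ cong (V +_) (sym (+-identityʳ V)) ⟩
          2 * V                                         ∎)
          where
          lemma : ∀ x s k → 2 * (x * (s * (10 * suc k))) ≡ 2 * (x * (s * 10)) * k + 2 * (x * (s * 10))
          lemma = solve-∀
          2L≤n : 2 * L ≤ V
          2L≤n = ≤-trans (≤-trans (m≤m+n (2 * L) arity) (m≤n+m _ N)) b≤n
        build : (Σ (Hypergraph V arity (C * V)) λ H → LargeSetsContainEdge (b + b) H × Sparse J H) → Reflexive T
        build (H , edge , sparse) =
          colour (width (instanceOf H) (LocallySolvable H Product (k V) , strategy H s>0 r≥2 two-step (k V) sparse))
          where
          colour : instanceOf H ⟶ T → Reflexive T
          colour (f , hom) =
            let c , fibre≥ = large-fibre (size T) (b + b) f t>0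
                i , inj , i⊆ = edge (fibre f c) fibre≥
            in monochromatic H f hom i inj c λ p → ∈-fibre⁻ f c (i⊆ p)

bounded⇒sublinear : ∀ {k} → IsBigO1 k → IsLittleON k
bounded⇒sublinear (C , N , k≤C) c = N + c * C , λ n N+cC≤n →
  ≤-trans (*-monoʳ-≤ c (k≤C n (≤-trans (m≤m+n N _) N+cC≤n))) (≤-trans (m≤n+m (c * C) N) N+cC≤n)

theorem4p1 : (σ : Signature) (S T : Structure σ) → S ⟶ T
    → 1 ≤ size S
    → (∀ R → ∃ λ t → rel S R t ≡ true)
    → (∀ (i j : 𝒢Index {σ}) → IsFull (𝒢 S i ∘ᵣ 𝒢 S j))
    → (SublinearWidth S T → Reflexive T) × (BoundedWidth S T → Reflexive T)
theorem4p1 σ S T S⟶T s>0 nonempty full =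
  sublinear , λ (k , bounded , width) → sublinear (k , bounded⇒sublinear bounded , width)
  where
  open Template S T
  inhabited : ∀ {n} → Fin n → 0 < n
  inhabited i = ≤-trans z<s (Fin.toℕ<n i)
  t>0 : 0 < size T
  t>0 = inhabited (proj₁ S⟶T (fromℕ< s>0))
  sublinear : SublinearWidth S T → Reflexive T
  sublinear width with 2 ≤? arity
  ... | yes r≥2 = reflexive-large-arity s>0 t>0 r≥2 (product-twoStep full) width
  ... | no  r≱2 = reflexive-small-arity S⟶T t>0 nonempty (≤-pred (≰⇒> r≱2))
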